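{- Let $c,r$ be positive integers with $c+1<r<2c$, and let $n>\frac{r-c-1}{c}\binom{r}{2}+r-1$. Then $R^c(B^rK_n)\le \frac{c}{r-c-1}\,n$.
   Context: An $r$-uniform hypergraph ($r$-graph) consists of a vertex set and a set of $r$-element subsets of it (hyperedges); $\mathcal{K}_N^r$ denotes the complete $r$-graph on $N$ vertices and $K_n$ the complete graph on $n$ vertices. For a graph $F$, an $r$-graph $\mathcal{H}$ contains a Berge-$F$ if there are an injection $\varphi:V(F)\to V(\mathcal{H})$ and an injection $f$ from $E(F)$ to the hyperedges of $\mathcal{H}$ with $\{\varphi(x),\varphi(y)\}\subseteq f(xy)$ for every edge $xy$; $B^rF$ is the family of $r$-uniform Berge copies of $F$. A $c$-coloring assigns to each hyperedge one of the colors $1,\dots,c$. $R^c(B^rK_n)$ is the smallest $N$ such that in every $c$-coloring of $\mathcal{K}_N^r$ the hyperedges of some single color contain a Berge-$K_n$. -}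

module Defs where

open import Data.Nat using (ℕ; _+_; _*_; _∸_; _<_; _≤_)
open import Data.Nat.Combinatorics using (_C_)
open import Data.Fin using (Fin) renaming (_<_ to _<ᶠ_)
open import Data.Fin.Subset using (Subset; ∣_∣; _∈_)
open import Data.Product using (Σ; ∃; ∃-syntax; _×_)
open import Function.Definitions using (Injective)
open import Relation.Binary.PropositionalEquality using (_≡_)

IsHyperedge : (N r : ℕ) → Subset N → Set
IsHyperedge N r e = ∣ e ∣ ≡ r

-- A c-colouring of K_N^r.  It is given as a function on all subsets of
-- Fin N; only its values on r-element subsets matter (every colouring of the
-- r-subsets extends to such a function).
Colouring : (c N : ℕ) → Set
Colouring c N = Subset N → Fin c

BergeKn-in-colour : (n N r c : ℕ) → Colouring c N → Fin c → Set
BergeKn-in-colour n N r c χ i =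
  Σ (Fin n → Fin N) λ φ →
  Σ ((x y : Fin n) → Subset N) λ f →
    Injective _≡_ _≡_ φ
    × (∀ x y x' y' → x <ᶠ y → x' <ᶠ y' → f x y ≡ f x' y' → (x ≡ x' × y ≡ y'))
    × (∀ x y → x <ᶠ y →
         IsHyperedge N r (f x y) × χ (f x y) ≡ i × φ x ∈ f x y × φ y ∈ f x y)

-- N has the Ramsey property: every c-colouring of K_N^r has a colour class
-- containing a Berge-K_n.  R^c(B^r K_n) is the least such N.
RamseyProperty : (c r n N : ℕ) → Set
RamseyProperty c r n N =
  (χ : Colouring c N) → ∃[ i ] BergeKn-in-colour n N r c χ i

{-# OPTIONS --safe #-}

-- Call a pair of vertices good in colour i if at least r C 2 edges of colour i contain it, and
-- bad otherwise.  An r-set contains r C 2 pairs, so by Hall's theorem a clique of n good pairs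
-- in one colour carries a Berge-K_n.  Suppose there is no such clique in any colour, so that
-- every set of n vertices contains a bad pair of every colour.
--
-- Put q = r − c − 1 and k = c − q ≥ 2, and let N be maximal with q N ≤ c n.  An edge that
-- contains bad pairs of all colours contains one of its own colour, and few edges can do so.
-- Hence no r − 2 vertices span bad pairs of all colours: adding two further vertices would
-- give too many such edges.
--
-- A Caro–Wei argument with the weights 1 (isolated) and 1/(k+1) (bad degree between 1 and k)
-- gives a vertex v of total weight < q over the c colours.  Take at v a bad neighbour in each
-- colour in which it is not isolated, and any bad pair in each other colour: by the previous
-- paragraph exactly q − 1 colours are isolated at v, and the weight then forces bad degree > k
-- in some colour i₀.  Varying the i₀-neighbour among k + 1 choices, the bad pair of one
-- isolated colour (if q ≥ 2) along a matching, and one free vertex, yields again more edges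
-- than the bad pairs involved can account for.

module Submission where

open import Defs
open import Data.Bool using (true; false)
import Data.Bool.Properties as Bool
open import Data.Empty using (⊥; ⊥-elim)
open import Data.Fin using (Fin; zero; suc; _≟_; inject≤; punchIn; punchOut) renaming (_<_ to _<ᶠ_)
open import Data.Fin.Properties using
  (suc-injective; <-cmp; any?; all?; <⇒≢; <-asym; _<?_; toℕ-inject≤; inject≤-injective; punchIn-punchOut)
open import Data.Fin.Subset using (Subset; ∣_∣; ⁅_⁆; _∪_) renaming (_∈_ to _∈ˢ_; ⊥ to ∅)
open import Data.Fin.Subset.Properties using (∉⊥; x∈⁅x⁆; x∈⁅y⁆⇒x≡y; x∈p∪q⁺; x∈p∪q⁻) renaming (_∈?_ to _∈ˢ?_)
open import Data.List as List using
  (List; []; _∷_; _++_; map; length; filter; concatMap; allFin; tabulate; lookup; cartesianProduct)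
open import Data.List.Properties using (length-map; length-++; length-filter; length-tabulate; map-tabulate; map-cong)
open import Data.List.Membership.Propositional using (_∈_; _∉_; find; lose)
open import Data.List.Membership.Propositional.Properties
import Data.List.Membership.DecPropositional as DecMem
open import Data.List.Relation.Unary.All as All using ([]; _∷_)
open import Data.List.Relation.Unary.All.Properties using (¬Any⇒All¬; All¬⇒¬Any)
open import Data.List.Relation.Unary.AllPairs using (AllPairs; []; _∷_)
import Data.List.Relation.Unary.AllPairs.Properties as AllPairs
open import Data.List.Relation.Unary.Any as Any using (here; there)
open import Data.List.Relation.Unary.Unique.Propositional using (Unique)
import Data.List.Relation.Unary.Unique.Propositional.Properties as Uniq
open import Data.Nat using
  (ℕ; zero; suc; _+_; _*_; _∸_; _/_; _%_; _<_; _≤_; z≤n; s≤s; s≤s⁻¹; _≤?_; >-nonZero; ⌊_/2⌋; ⌈_/2⌉)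
open import Data.Nat.Combinatorics using (_C_; nC1≡n; nCk+nC[k+1]≡[n+1]C[k+1])
open import Data.Nat.DivMod using (m/n*n≤m; m≡m%n+[m/n]*n; m%n<n)
open import Data.Nat.ListAction using (sum)
open import Data.Nat.Properties as ℕ hiding (_≟_; _≤?_; _<?_; suc-injective; <-cmp; <⇒≢; <-asym)
open import Algebra.Properties.CommutativeSemigroup +-commutativeSemigroup using (interchange; x∙yz≈y∙xz)
open import Data.Nat.Tactic.RingSolver using (solve-∀)
open import Data.Product using (Σ; ∃; ∃-syntax; _×_; _,_; proj₁; proj₂)
open import Data.Product.Properties using (≡-dec)
open import Data.Sum using (_⊎_; inj₁; inj₂)
open import Data.Vec as Vec using (Vec; []; _∷_; here; there)
import Data.Vec.Properties as Vec
open import Function using (_∘_; id)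
open import Relation.Binary.Definitions using (DecidableEquality; tri<; tri≈; tri>)
open import Relation.Binary.PropositionalEquality
open import Relation.Nullary using (Dec; yes; no; ¬_; ¬?; _×-dec_; _→-dec_; contradiction; decidable-stable)
open import Relation.Nullary.Decidable using (map′)
open import Relation.Unary using (Decidable)

private variable
  A B : Set

∑ : List A → (A → ℕ) → ℕ
∑ xs f = sum (map f xs)

∑-mono : (xs : List A) {f g : A → ℕ} → (∀ {x} → x ∈ xs → f x ≤ g x) → ∑ xs f ≤ ∑ xs g
∑-mono []       h = z≤n
∑-mono (x ∷ xs) h = +-mono-≤ (h (here refl)) (∑-mono xs (h ∘ there))

∑-const : (xs : List A) (d : ℕ) → ∑ xs (λ _ → d) ≡ length xs * d
∑-const []       d = refl
∑-const (x ∷ xs) d = cong (d +_) (∑-const xs d)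

∑-+ : (xs : List A) (f g : A → ℕ) → ∑ xs (λ x → f x + g x) ≡ ∑ xs f + ∑ xs g
∑-+ []       f g = refl
∑-+ (x ∷ xs) f g = trans (cong (f x + g x +_) (∑-+ xs f g)) (interchange (f x) (g x) _ _)

∑-*ˡ : (xs : List A) (d : ℕ) (f : A → ℕ) → ∑ xs (λ x → d * f x) ≡ d * ∑ xs f
∑-*ˡ []       d f = sym (*-zeroʳ d)
∑-*ˡ (x ∷ xs) d f = trans (cong (d * f x +_) (∑-*ˡ xs d f)) (sym (*-distribˡ-+ d (f x) _))

∑-comm : (xs : List A) (ys : List B) (f : A → B → ℕ) →
         ∑ xs (λ x → ∑ ys (f x)) ≡ ∑ ys (λ y → ∑ xs (λ x → f x y))
∑-comm []       ys f = sym (trans (∑-const ys 0) (*-zeroʳ (length ys)))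
∑-comm (x ∷ xs) ys f = trans (cong (∑ ys (f x) +_) (∑-comm xs ys f)) (sym (∑-+ ys (f x) _))

∑-≤-bound : (xs : List A) {f : A → ℕ} {d : ℕ} → (∀ {x} → x ∈ xs → f x ≤ d) → ∑ xs f ≤ length xs * d
∑-≤-bound xs {d = d} h = ≤-trans (∑-mono xs h) (≤-reflexive (∑-const xs d))

∑-≥-bound : (xs : List A) {f : A → ℕ} {d : ℕ} → (∀ {x} → x ∈ xs → d ≤ f x) → length xs * d ≤ ∑ xs f
∑-≥-bound xs {d = d} h = ≤-trans (≤-reflexive (sym (∑-const xs d))) (∑-mono xs h)

⟦_⟧ : ∀ {p} {P : Set p} → Dec P → ℕ
⟦ yes _ ⟧ = 1
⟦ no _ ⟧ = 0

length-filter≡∑ : ∀ {P : A → Set} (P? : Decidable P) xs → length (filter P? xs) ≡ ∑ xs (λ x → ⟦ P? x ⟧)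
length-filter≡∑ P? [] = refl
length-filter≡∑ P? (x ∷ xs) with P? x
... | yes _ = cong suc (length-filter≡∑ P? xs)
... | no _  = length-filter≡∑ P? xs

double-counting : {R : A → B → Set} (R? : ∀ x y → Dec (R x y)) (xs : List A) (ys : List B) {d e : ℕ} →
  (∀ {x} → x ∈ xs → d ≤ length (filter (R? x) ys)) →
  (∀ {y} → y ∈ ys → length (filter (λ x → R? x y) xs) ≤ e) →
  length xs * d ≤ length ys * e
double-counting R? xs ys {d} {e} lo hi = begin
  length xs * d                           ≤⟨ ∑-≥-bound xs (λ {x} m → ≤-trans (lo m) (≤-reflexive (length-filter≡∑ (R? x) ys))) ⟩
  ∑ xs (λ x → ∑ ys (λ y → ⟦ R? x y ⟧))   ≡⟨ ∑-comm xs ys _ ⟩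
  ∑ ys (λ y → ∑ xs (λ x → ⟦ R? x y ⟧))   ≤⟨ ∑-≤-bound ys (λ {y} m → ≤-trans (≤-reflexive (sym (length-filter≡∑ (λ x → R? x y) xs))) (hi m)) ⟩
  length ys * e                           ∎
  where open ≤-Reasoning

infix 4 _⊑_
_⊑_ : List A → List A → Set
xs ⊑ ys = ∀ {x} → x ∈ xs → x ∈ ys

unique-head : {x : A} {xs : List A} → Unique (x ∷ xs) → x ∉ xs
unique-head (x≢ ∷ _) = All¬⇒¬Any x≢

unique-cons : {x : A} {xs : List A} → x ∉ xs → Unique xs → Unique (x ∷ xs)
unique-cons x∉ u = ¬Any⇒All¬ _ x∉ ∷ u

unique-tail : {x : A} {xs : List A} → Unique (x ∷ xs) → Unique xs
unique-tail (_ ∷ u) = u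

unique-⊑⇒length≤ : {xs ys : List A} → Unique xs → xs ⊑ ys → length xs ≤ length ys
unique-⊑⇒length≤ {xs = []}     u s = z≤n
unique-⊑⇒length≤ {xs = x ∷ xs} u s with ∈-∃++ (s (here refl))
... | as , bs , refl = begin
  suc (length xs)          ≤⟨ s≤s (unique-⊑⇒length≤ (unique-tail u) s′) ⟩
  suc (length (as ++ bs))  ≡⟨ cong suc (length-++ as) ⟩
  suc (length as + length bs) ≡⟨ +-suc (length as) _ ⟨
  length as + length (x ∷ bs) ≡⟨ length-++ as ⟨
  length (as ++ x ∷ bs)    ∎
  where
  open ≤-Reasoning
  s′ : xs ⊑ as ++ bs
  s′ {y} m with ∈-++⁻ as (s (there m))
  ... | inj₁ p           = ∈-++⁺ˡ p
  ... | inj₂ (here refl) = contradiction m (unique-head u)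
  ... | inj₂ (there p)   = ∈-++⁺ʳ as p

lookup-injective : {xs : List A} → Unique xs → ∀ {i j} → lookup xs i ≡ lookup xs j → i ≡ j
lookup-injective {xs = x ∷ xs} u {zero}  {zero}  e = refl
lookup-injective {xs = x ∷ xs} u {zero}  {suc j} e = contradiction (subst (_∈ xs) (sym e) (∈-lookup j)) (unique-head u)
lookup-injective {xs = x ∷ xs} u {suc i} {zero}  e = contradiction (subst (_∈ xs) e (∈-lookup i)) (unique-head u)
lookup-injective {xs = x ∷ xs} u {suc i} {suc j} e = cong suc (lookup-injective (unique-tail u) e)

pairs : List A → List (A × A)
pairs []       = []
pairs (x ∷ xs) = map (x ,_) xs ++ pairs xs

length-pairs : (xs : List A) → length (pairs xs) ≡ length xs C 2
length-pairs []       = refl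
length-pairs (x ∷ xs) = begin
  length (map (x ,_) xs ++ pairs xs)          ≡⟨ length-++ (map (x ,_) xs) ⟩
  length (map (x ,_) xs) + length (pairs xs)  ≡⟨ cong₂ _+_ (trans (length-map (x ,_) xs) (sym (nC1≡n (length xs)))) (length-pairs xs) ⟩
  length xs C 1 + length xs C 2               ≡⟨ nCk+nC[k+1]≡[n+1]C[k+1] (length xs) 1 ⟩
  suc (length xs) C 2                         ∎
  where open ≡-Reasoning

C2-mono : ∀ {m n} → m ≤ n → m C 2 ≤ n C 2
C2-mono {n = n} z≤n = z≤n
C2-mono {suc m} {suc n} (s≤s m≤n) =
  subst₂ _≤_ (nCk+nC[k+1]≡[n+1]C[k+1] m 1) (nCk+nC[k+1]≡[n+1]C[k+1] n 1)
    (+-mono-≤ (subst₂ _≤_ (sym (nC1≡n m)) (sym (nC1≡n n)) m≤n) (C2-mono m≤n))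

∈-pairs-filter : {P : A → Set} (P? : Decidable P) (xs : List A) {x y : A} →
  (x , y) ∈ pairs xs → P x → P y → (x , y) ∈ pairs (filter P? xs)
∈-pairs-filter P? (z ∷ xs) {x} {y} m px py with ∈-++⁻ (map (z ,_) xs) m | P? z
... | inj₂ m₂ | yes _ = ∈-++⁺ʳ _ (∈-pairs-filter P? xs m₂ px py)
... | inj₂ m₂ | no _  = ∈-pairs-filter P? xs m₂ px py
... | inj₁ m₁ | d with ∈-map⁻ (z ,_) m₁
...   | _ , my , refl with d
...     | yes _  = ∈-++⁺ˡ (∈-map⁺ _ (∈-filter⁺ P? my py))
...     | no ¬pz = contradiction px ¬pz

unique-pairs : {xs : List A} → Unique xs → Unique (pairs xs)
unique-pairs {xs = []}     u = []
unique-pairs {xs = x ∷ xs} u = Uniq.++⁺ (Uniq.map⁺ (λ { refl → refl }) (unique-tail u)) (unique-pairs (unique-tail u)) disj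
  where
  fst∈ : ∀ (zs : List _) {a b} → (a , b) ∈ pairs zs → a ∈ zs
  fst∈ (z ∷ zs) m with ∈-++⁻ (map (z ,_) zs) m
  ... | inj₂ m₂ = there (fst∈ zs m₂)
  ... | inj₁ m₁ with ∈-map⁻ (z ,_) m₁
  ...   | _ , _ , refl = here refl
  disj : ∀ {p} → p ∈ map (x ,_) xs × p ∈ pairs xs → ⊥
  disj (m₁ , m₂) with ∈-map⁻ (x ,_) m₁
  ... | _ , _ , refl = unique-head u (fst∈ xs m₂)

-- Hall's theorem for bipartite graphs with left degrees ≥ d and right degrees ≤ d

module Hall {A B : Set} (_≟_ : DecidableEquality A) (_≟ᴮ_ : DecidableEquality B)
            (default : B) (nb : A → List B) (d : ℕ) (0<d : 0 < d) where

  open DecMem _≟_ using () renaming (_∈?_ to _∈ᴬ?_)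
  open DecMem _≟ᴮ_ using () renaming (_∈?_ to _∈ᴮ?_)

  record Matching (P : A → Set) : Set where
    field
      to    : A → B
      valid : ∀ {l} → P l → to l ∈ nb l
      inj   : ∀ {l m} → P l → P m → to l ≡ to m → l ≡ m
  open Matching

  DegreeBound : List A → Set
  DegreeBound L = ∀ {S} y → Unique S → S ⊑ L → length (filter (λ l → y ∈ᴮ? nb l) S) ≤ d

  _[_↦_] : (A → B) → A → B → A → B
  (h [ l ↦ y ]) m with m ≟ l
  ... | yes _ = y
  ... | no _  = h m

  module Augment (p : A) (L : List A) (uL : Unique (p ∷ L))
                 (deg : ∀ {l} → l ∈ p ∷ L → Unique (nb l) × d ≤ length (nb l))
                 (bound : DegreeBound (p ∷ L)) (M : Matching (_∈ L)) where

    -- M rerouted along an alternating path so that l is the only unmatched vertex;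
    -- vertices outside the search tree S keep their partner.
    record Freed (S : List A) (l : A) : Set where
      field
        matching : Matching (λ m → m ∈ p ∷ L × m ≢ l)
        image    : ∀ {m} → m ∈ p ∷ L → m ≢ l → ∃[ m′ ] m′ ∈ L × to matching m ≡ to M m′
        stay     : ∀ {m} → m ∈ L → m ∉ S → to matching m ≡ to M m
    open Freed

    reroute : ∀ {l y l′} (F : Matching (λ m → m ∈ p ∷ L × m ≢ l)) → y ∈ nb l →
              (∀ {m} → m ∈ p ∷ L → m ≢ l → to F m ≡ y → m ≡ l′) →
              Matching (λ m → m ∈ p ∷ L × m ≢ l′)
    reroute {l} {y} {l′} F y∈ own = record { to = h ; valid = val ; inj = in′ }
      where
      h = to F [ l ↦ y ]
      val : ∀ {m} → m ∈ p ∷ L × m ≢ l′ → h m ∈ nb m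
      val {m} (m∈ , _) with m ≟ l
      ... | yes refl = y∈
      ... | no m≢l   = valid F (m∈ , m≢l)
      in′ : ∀ {m o} → m ∈ p ∷ L × m ≢ l′ → o ∈ p ∷ L × o ≢ l′ → h m ≡ h o → m ≡ o
      in′ {m} {o} (m∈ , m≢) (o∈ , o≢) e with m ≟ l | o ≟ l
      ... | yes refl | yes refl = refl
      ... | yes refl | no o≢l   = contradiction (own o∈ o≢l (sym e)) o≢
      ... | no m≢l   | yes refl = contradiction (own m∈ m≢l e) m≢
      ... | no m≢l   | no o≢l   = inj F (m∈ , m≢l) (o∈ , o≢l) e

    complete : ∀ {l y} (F : Matching (λ m → m ∈ p ∷ L × m ≢ l)) → y ∈ nb l →
               (∀ {m} → m ∈ p ∷ L → m ≢ l → to F m ≢ y) → Matching (_∈ p ∷ L)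
    complete {l} {y} F y∈ new = record { to = h ; valid = val ; inj = in′ }
      where
      h = to F [ l ↦ y ]
      val : ∀ {m} → m ∈ p ∷ L → h m ∈ nb m
      val {m} m∈ with m ≟ l
      ... | yes refl = y∈
      ... | no m≢l   = valid F (m∈ , m≢l)
      in′ : ∀ {m o} → m ∈ p ∷ L → o ∈ p ∷ L → h m ≡ h o → m ≡ o
      in′ {m} {o} m∈ o∈ e with m ≟ l | o ≟ l
      ... | yes refl | yes refl = refl
      ... | yes refl | no o≢l   = contradiction (sym e) (new o∈ o≢l)
      ... | no m≢l   | yes refl = contradiction e (new m∈ m≢l)
      ... | no m≢l   | no o≢l   = inj F (m∈ , m≢l) (o∈ , o≢l) e

    partners : List A → List B
    partners S = map (to M) (filter (λ m → ¬? (m ≟ p)) S)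

    partners-length : ∀ {S} → Unique S → p ∈ S → length (partners S) < length S
    partners-length {S} uS p∈ = begin
      suc (length (partners S))      ≡⟨ cong suc (length-map (to M) (filter (λ m → ¬? (m ≟ p)) S)) ⟩
      length (p ∷ filter (λ m → ¬? (m ≟ p)) S) ≤⟨ unique-⊑⇒length≤
          (unique-cons (λ m → proj₂ (∈-filter⁻ (λ m → ¬? (m ≟ p)) {xs = S} m) refl) (Uniq.filter⁺ _ uS))
          (λ { (here refl) → p∈ ; (there m) → proj₁ (∈-filter⁻ (λ m → ¬? (m ≟ p)) {xs = S} m) }) ⟩
      length S ∎
      where open ≤-Reasoning

    -- otherwise |S| d ≤ |partners S| d by counting edges, although |partners S| < |S|
    escape : ∀ {S} → Unique S → S ⊑ p ∷ L → p ∈ S →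
             ∃[ l ] ∃[ y ] l ∈ S × y ∈ nb l × y ∉ partners S
    escape {S} uS S⊑ p∈ with Any.any? (λ l → Any.any? (λ y → ¬? (y ∈ᴮ? partners S)) (nb l)) S
    ... | yes found = let l , l∈ , rest = find found ; y , y∈ , y∉ = find rest in l , y , l∈ , y∈ , y∉
    ... | no none   = contradiction (double-counting (λ l y → y ∈ᴮ? nb l) S (partners S) lo hi)
                        (<⇒≱ (*-monoˡ-< d {{>-nonZero 0<d}} (partners-length uS p∈)))
      where
      closed : ∀ {l} → l ∈ S → nb l ⊑ partners S
      closed l∈ {y} y∈ = decidable-stable (y ∈ᴮ? partners S) λ y∉ →
        none (lose l∈ (lose y∈ y∉))
      lo : ∀ {l} → l ∈ S → d ≤ length (filter (λ y → y ∈ᴮ? nb l) (partners S))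
      lo l∈ = ≤-trans (proj₂ (deg (S⊑ l∈)))
        (unique-⊑⇒length≤ (proj₁ (deg (S⊑ l∈))) λ y∈ → ∈-filter⁺ _ (closed l∈ y∈) y∈)
      hi : ∀ {y} → y ∈ partners S → length (filter (λ l → y ∈ᴮ? nb l) S) ≤ d
      hi {y} _ = bound y uS S⊑

    grow : ∀ fuel {S} → Unique S → S ⊑ p ∷ L → p ∈ S → (∀ {l} → l ∈ S → Freed S l) →
           length (p ∷ L) ≤ fuel + length S → Matching (_∈ p ∷ L)
    grow fuel {S} uS S⊑ p∈ freed enough with escape uS S⊑ p∈
    ... | l , y , l∈ , y∈ , y∉ with y ∈ᴮ? map (to M) L
    ... | no new = complete (matching (freed l∈)) y∈ λ m∈ m≢l e →
      let m′ , m′∈ , e′ = image (freed l∈) m∈ m≢l in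
      new (subst (_∈ map (to M) L) (trans (sym e′) e) (∈-map⁺ (to M) m′∈))
    ... | yes old with ∈-map⁻ (to M) old
    ... | l′ , l′∈ , refl = continue fuel enough
      where
      l′≢p : l′ ≢ p
      l′≢p refl = unique-head uL l′∈
      l′∉S : l′ ∉ S
      l′∉S m = y∉ (∈-map⁺ (to M) (∈-filter⁺ _ m l′≢p))
      S′⊑ : l′ ∷ S ⊑ p ∷ L
      S′⊑ (here refl) = there l′∈
      S′⊑ (there m)   = S⊑ m
      F = freed l∈
      l≢l′ : l′ ≢ l
      l≢l′ refl = l′∉S l∈
      own : ∀ {m} → m ∈ p ∷ L → m ≢ l → to (matching F) m ≡ to M l′ → m ≡ l′
      own m∈ m≢l e = inj (matching F) (m∈ , m≢l) (there l′∈ , l≢l′) (trans e (sym (stay F l′∈ l′∉S)))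
      F′ : Freed (l′ ∷ S) l′
      F′ .matching = reroute (matching F) y∈ own
      F′ .image {m} m∈ m≢ with m ≟ l
      ... | yes refl = l′ , l′∈ , refl
      ... | no m≢l   = image F m∈ m≢l
      F′ .stay {m} m∈ m∉ with m ≟ l
      ... | yes refl = contradiction (there l∈) m∉
      ... | no _     = stay F m∈ (m∉ ∘ there)
      freed′ : ∀ {m} → m ∈ l′ ∷ S → Freed (l′ ∷ S) m
      freed′ (here refl) = F′
      freed′ (there m)   = record
        { matching = matching (freed m) ; image = image (freed m)
        ; stay = λ o∈ o∉ → stay (freed m) o∈ (o∉ ∘ there) }
      uS′ = unique-cons l′∉S uS
      continue : ∀ fuel → length (p ∷ L) ≤ fuel + length S → Matching (_∈ p ∷ L)
      continue zero       le = contradiction (unique-⊑⇒length≤ uS′ S′⊑) (<⇒≱ (s≤s le))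
      continue (suc fuel) le = grow fuel uS′ S′⊑ (there p∈) freed′
        (≤-trans le (≤-reflexive (sym (+-suc fuel (length S)))))

    augment : Matching (_∈ p ∷ L)
    augment = grow (length L) (unique-cons (λ ()) []) (λ { (here refl) → here refl }) (here refl) start
                (≤-reflexive (+-comm 1 (length L)))
      where
      ∈L : ∀ {m} → m ∈ p ∷ L → m ≢ p → m ∈ L
      ∈L (here refl) m≢p = contradiction refl m≢p
      ∈L (there m)   _   = m
      start : ∀ {l} → l ∈ p ∷ [] → Freed (p ∷ []) l
      start (here refl) = record
        { matching = record
            { to    = to M
            ; valid = λ (m∈ , m≢) → valid M (∈L m∈ m≢)
            ; inj   = λ (m∈ , m≢) (o∈ , o≢) → inj M (∈L m∈ m≢) (∈L o∈ o≢) }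
        ; image = λ m∈ m≢ → _ , ∈L m∈ m≢ , refl
        ; stay  = λ _ _ → refl }

  hall : (L : List A) → Unique L → (∀ {l} → l ∈ L → Unique (nb l) × d ≤ length (nb l)) →
         DegreeBound L → Matching (_∈ L)
  hall []      u deg bound = record { to = λ _ → default ; valid = λ () ; inj = λ () }
  hall (p ∷ L) u deg bound = Augment.augment p L u deg bound
    (hall L (unique-tail u) (deg ∘ there) (λ y uS S⊑ → bound y uS (there ∘ S⊑)))

-- Subsets of a finite set and codegrees

elements : ∀ {m} → Subset m → List (Fin m)
elements []          = []
elements (true ∷ X)  = zero ∷ map suc (elements X)
elements (false ∷ X) = map suc (elements X)

length-elements : ∀ {m} (X : Subset m) → length (elements X) ≡ ∣ X ∣
length-elements []          = refl
length-elements (true ∷ X)  = cong suc (trans (length-map suc (elements X)) (length-elements X))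
length-elements (false ∷ X) = trans (length-map suc (elements X)) (length-elements X)

∈-elements⁺ : ∀ {m} {X : Subset m} {x} → x ∈ˢ X → x ∈ elements X
∈-elements⁺ {X = true ∷ X}  here      = here refl
∈-elements⁺ {X = true ∷ X}  (there m) = there (∈-map⁺ suc (∈-elements⁺ m))
∈-elements⁺ {X = false ∷ X} (there m) = ∈-map⁺ suc (∈-elements⁺ m)

∈-elements⁻ : ∀ {m} (X : Subset m) {x} → x ∈ elements X → x ∈ˢ X
∈-elements⁻ (true ∷ X)  (here refl) = here
∈-elements⁻ (true ∷ X)  (there m) with ∈-map⁻ suc m
... | _ , m′ , refl = there (∈-elements⁻ X m′)
∈-elements⁻ (false ∷ X) m with ∈-map⁻ suc m
... | _ , m′ , refl = there (∈-elements⁻ X m′)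

unique-elements : ∀ {m} (X : Subset m) → Unique (elements X)
unique-elements []          = []
unique-elements (true ∷ X)  = unique-cons zero∉ (Uniq.map⁺ suc-injective (unique-elements X))
  where
  zero∉ : zero ∉ map suc (elements X)
  zero∉ m with ∈-map⁻ suc m
  ... | _ , _ , ()
unique-elements (false ∷ X) = Uniq.map⁺ suc-injective (unique-elements X)

fromList : ∀ {m} → List (Fin m) → Subset m
fromList []       = ∅
fromList (x ∷ xs) = ⁅ x ⁆ ∪ fromList xs

∈-fromList⁺ : ∀ {m} {xs : List (Fin m)} {x} → x ∈ xs → x ∈ˢ fromList xs
∈-fromList⁺ (here refl) = x∈p∪q⁺ (inj₁ (x∈⁅x⁆ _))
∈-fromList⁺ (there m)   = x∈p∪q⁺ (inj₂ (∈-fromList⁺ m))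

∈-fromList⁻ : ∀ {m} (xs : List (Fin m)) {x} → x ∈ˢ fromList xs → x ∈ xs
∈-fromList⁻ []       m = contradiction m ∉⊥
∈-fromList⁻ (y ∷ xs) m with x∈p∪q⁻ ⁅ y ⁆ (fromList xs) m
... | inj₁ p = here (x∈⁅y⁆⇒x≡y y p)
... | inj₂ p = there (∈-fromList⁻ xs p)

∣fromList∣ : ∀ {m} {xs : List (Fin m)} → Unique xs → ∣ fromList xs ∣ ≡ length xs
∣fromList∣ {xs = xs} u = trans (sym (length-elements (fromList xs))) (≤-antisym
  (unique-⊑⇒length≤ (unique-elements (fromList xs)) (∈-fromList⁻ xs ∘ ∈-elements⁻ _))
  (unique-⊑⇒length≤ u (∈-elements⁺ ∘ ∈-fromList⁺)))

allSubsets : ∀ m → List (Subset m)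
allSubsets zero    = [] ∷ []
allSubsets (suc m) = map (true ∷_) (allSubsets m) ++ map (false ∷_) (allSubsets m)

∈-allSubsets : ∀ {m} (X : Subset m) → X ∈ allSubsets m
∈-allSubsets []          = here refl
∈-allSubsets (true ∷ X)  = ∈-++⁺ˡ (∈-map⁺ _ (∈-allSubsets X))
∈-allSubsets (false ∷ X) = ∈-++⁺ʳ _ (∈-map⁺ _ (∈-allSubsets X))

unique-allSubsets : ∀ m → Unique (allSubsets m)
unique-allSubsets zero    = [] ∷ []
unique-allSubsets (suc m) = Uniq.++⁺ (Uniq.map⁺ (cong Vec.tail) (unique-allSubsets m))
                                     (Uniq.map⁺ (cong Vec.tail) (unique-allSubsets m)) disj
  where
  disj : ∀ {X} → X ∈ map (true ∷_) (allSubsets m) × X ∈ map (false ∷_) (allSubsets m) → ⊥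
  disj (m₁ , m₂) with ∈-map⁻ (true ∷_) m₁ | ∈-map⁻ (false ∷_) m₂
  ... | _ , _ , refl | _ , _ , ()

pairs-AllPairs : {A : Set} {R : A → A → Set} {xs : List A} → AllPairs R xs → ∀ {x y} → (x , y) ∈ pairs xs → R x y
pairs-AllPairs {xs = z ∷ xs} (Rz ∷ ap) m with ∈-++⁻ (map (z ,_) xs) m
... | inj₂ m₂ = pairs-AllPairs ap m₂
... | inj₁ m₁ with ∈-map⁻ (z ,_) m₁
...   | _ , my , refl = All.lookup Rz my

∈-pairs : {A : Set} {xs : List A} {x y : A} → x ∈ xs → y ∈ xs → x ≡ y ⊎ (x , y) ∈ pairs xs ⊎ (y , x) ∈ pairs xs
∈-pairs (here refl) (here refl) = inj₁ refl
∈-pairs (here refl) (there my)  = inj₂ (inj₁ (∈-++⁺ˡ (∈-map⁺ _ my)))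
∈-pairs (there mx)  (here refl) = inj₂ (inj₂ (∈-++⁺ˡ (∈-map⁺ _ mx)))
∈-pairs (there mx)  (there my) with ∈-pairs mx my
... | inj₁ e        = inj₁ e
... | inj₂ (inj₁ m) = inj₂ (inj₁ (∈-++⁺ʳ _ m))
... | inj₂ (inj₂ m) = inj₂ (inj₂ (∈-++⁺ʳ _ m))

allFin-increasing : ∀ n → AllPairs _<ᶠ_ (allFin n)
allFin-increasing n = AllPairs.tabulate⁺-< id

module Codegree {c N : ℕ} (r : ℕ) (χ : Colouring c N) where

  Edge : Fin c → Fin N → Fin N → Subset N → Set
  Edge i u v X = ∣ X ∣ ≡ r × χ X ≡ i × u ∈ˢ X × v ∈ˢ X

  edge? : ∀ i u v X → Dec (Edge i u v X)
  edge? i u v X = (∣ X ∣ ℕ.≟ r) ×-dec (χ X ≟ i) ×-dec (u ∈ˢ? X) ×-dec (v ∈ˢ? X)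

  edges : Fin c → Fin N → Fin N → List (Subset N)
  edges i u v = filter (edge? i u v) (allSubsets N)

  unique-edges : ∀ i u v → Unique (edges i u v)
  unique-edges i u v = Uniq.filter⁺ (edge? i u v) (unique-allSubsets N)

  ∈-edges⁺ : ∀ {i u v X} → Edge i u v X → X ∈ edges i u v
  ∈-edges⁺ {i} {u} {v} {X} = ∈-filter⁺ (edge? i u v) (∈-allSubsets X)

  ∈-edges⁻ : ∀ {i u v X} → X ∈ edges i u v → Edge i u v X
  ∈-edges⁻ {i} {u} {v} m = proj₂ (∈-filter⁻ (edge? i u v) {xs = allSubsets N} m)

  Good : Fin c → Fin N → Fin N → Set
  Good i u v = u ≢ v × r C 2 ≤ length (edges i u v)

  Bad : Fin c → Fin N → Fin N → Set
  Bad i u v = u ≢ v × length (edges i u v) < r C 2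

  good? : ∀ i u v → Dec (Good i u v)
  good? i u v = ¬? (u ≟ v) ×-dec (r C 2 ≤? length (edges i u v))

  bad? : ∀ i u v → Dec (Bad i u v)
  bad? i u v = ¬? (u ≟ v) ×-dec (suc (length (edges i u v)) ≤? r C 2)

  bad-sym : ∀ {i u v} → Bad i u v → Bad i v u
  bad-sym (u≢v , lt) = u≢v ∘ sym , ≤-<-trans
    (unique-⊑⇒length≤ (unique-edges _ _ _) λ m → let e , f , g , h = ∈-edges⁻ m in ∈-edges⁺ (e , f , h , g)) lt

  GoodClique : (n : ℕ) → Fin c → (Fin n → Fin N) → Set
  GoodClique n i φ = ∀ x y → x <ᶠ y → Good i (φ x) (φ y)

  -- Hall's theorem applies since an r-set contains at most r C 2 of the pairs of the clique.
  goodClique⇒Berge : ∀ {n i} {φ : Fin n → Fin N} → 0 < r C 2 → GoodClique n i φ → BergeKn-in-colour n N r c χ i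
  goodClique⇒Berge {n} {i} {φ} C>0 good =
    φ , (λ x y → to (x , y)) , φ-injective
      , (λ x y x′ y′ x<y x′<y′ e → let e′ = inj (∈L x<y) (∈L x′<y′) e in cong proj₁ e′ , cong proj₂ e′)
      , (λ x y x<y → ∈-edges⁻ (valid (∈L x<y)))
    where
    φ-injective : ∀ {x y} → φ x ≡ φ y → x ≡ y
    φ-injective {x} {y} e with <-cmp x y
    ... | tri< x<y _ _ = contradiction e (proj₁ (good x y x<y))
    ... | tri≈ _ x≡y _ = x≡y
    ... | tri> _ _ y<x = contradiction (sym e) (proj₁ (good y x y<x))
    L = pairs (allFin n)
    ∈L : ∀ {x y} → x <ᶠ y → (x , y) ∈ L
    ∈L {x} {y} x<y with ∈-pairs (∈-allFin x) (∈-allFin y)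
    ... | inj₁ refl     = contradiction refl (<⇒≢ x<y)
    ... | inj₂ (inj₁ m) = m
    ... | inj₂ (inj₂ m) = contradiction (pairs-AllPairs (allFin-increasing n) m) (<-asym x<y)
    nb : Fin n × Fin n → List (Subset N)
    nb (x , y) = edges i (φ x) (φ y)
    open Hall (≡-dec _≟_ _≟_) (Vec.≡-dec Bool._≟_) ∅ nb (r C 2) C>0
    open DecMem {A = Subset N} (Vec.≡-dec Bool._≟_) using () renaming (_∈?_ to _∈ᴸ?_)
    bound : DegreeBound L
    bound {S} X uS S⊑ with ∣ X ∣ ℕ.≟ r
    ... | no ∣X∣≢r = ≤-trans (unique-⊑⇒length≤ {ys = []} (Uniq.filter⁺ _ uS) λ m →
            contradiction (proj₁ (∈-edges⁻ (proj₂ (∈-filter⁻ (λ l → X ∈ᴸ? nb l) {xs = S} m)))) ∣X∣≢r) z≤n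
    ... | yes refl = begin
      length (filter (λ l → X ∈ᴸ? nb l) S) ≤⟨ unique-⊑⇒length≤ (Uniq.filter⁺ _ uS) (λ m →
            let l∈ , X∈ = ∈-filter⁻ (λ l → X ∈ᴸ? nb l) {xs = S} m
                _ , _ , x∈ , y∈ = ∈-edges⁻ X∈
            in ∈-pairs-filter inX? (allFin n) (S⊑ l∈) x∈ y∈) ⟩
      length (pairs inside)                ≡⟨ length-pairs inside ⟩
      length inside C 2                    ≤⟨ C2-mono (subst₂ _≤_ (length-map φ inside) (length-elements X)
            (unique-⊑⇒length≤ (Uniq.map⁺ φ-injective (Uniq.filter⁺ inX? (Uniq.allFin⁺ n))) inside⊑)) ⟩
      ∣ X ∣ C 2                            ∎
      where
      open ≤-Reasoning
      inX? = λ x → φ x ∈ˢ? X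
      inside = filter inX? (allFin n)
      inside⊑ : map φ inside ⊑ elements X
      inside⊑ m with ∈-map⁻ φ m
      ... | x , x∈ , refl = ∈-elements⁺ (proj₂ (∈-filter⁻ inX? {xs = allFin n} x∈))
    open Matching (hall L (unique-pairs (Uniq.allFin⁺ n))
      (λ {l} l∈ → unique-edges _ _ _ , proj₂ (good _ _ (pairs-AllPairs (allFin-increasing n) l∈))) bound)

  anyVec? : ∀ {A : Set} m → (∀ {P : A → Set} → (∀ x → Dec (P x)) → Dec (∃ P)) →
            {P : Vec A m → Set} → (∀ xs → Dec (P xs)) → Dec (∃ P)
  anyVec? zero    search P? = map′ (λ p → [] , p) (λ { ([] , p) → p }) (P? [])
  anyVec? (suc m) search P? = map′ (λ (x , xs , p) → x ∷ xs , p) (λ { (x ∷ xs , p) → x , xs , p })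
    (search λ x → anyVec? m search λ xs → P? (x ∷ xs))

  goodClique? : ∀ n i → Dec (∃[ xs ] GoodClique n i (Vec.lookup xs))
  goodClique? n i = anyVec? n any? λ xs → all? λ x → all? λ y → (x <? y) →-dec good? i _ _

  clique-lookup : ∀ {i xs} → AllPairs (Good i) xs → ∀ x y → x <ᶠ y → Good i (List.lookup xs x) (List.lookup xs y)
  clique-lookup (g ∷ ap) zero    (suc y) _         = All.lookup g (∈-lookup y)
  clique-lookup (g ∷ ap) (suc x) (suc y) (s≤s x<y) = clique-lookup ap x y x<y

  goodList⇒goodClique : ∀ {n i xs} → AllPairs (Good i) xs → n ≤ length xs → ∃[ ys ] GoodClique n i (Vec.lookup ys)
  goodList⇒goodClique {n} {i} {xs} ap n≤ = Vec.tabulate f , λ x y x<y →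
    subst₂ (Good i) (sym (Vec.lookup∘tabulate f x)) (sym (Vec.lookup∘tabulate f y))
      (clique-lookup ap (inject≤ x n≤) (inject≤ y n≤)
        (subst₂ _<_ (sym (toℕ-inject≤ x n≤)) (sym (toℕ-inject≤ y n≤)) x<y))
    where f = λ x → List.lookup xs (inject≤ x n≤)

  Berge-or-sparse : ∀ n → 0 < r C 2 →
    (∃[ i ] BergeKn-in-colour n N r c χ i) ⊎ (∀ i {xs} → AllPairs (Good i) xs → length xs < n)
  Berge-or-sparse n C>0 with any? (goodClique? n)
  ... | yes (i , xs , good) = inj₁ (i , goodClique⇒Berge C>0 good)
  ... | no none = inj₂ λ i ap → ≰⇒> λ n≤ → none (i , goodList⇒goodClique ap n≤)

-- Colourings without large good cliques

length-cartesianProduct : (xs : List A) (ys : List B) → length (cartesianProduct xs ys) ≡ length xs * length ys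
length-cartesianProduct []       ys = refl
length-cartesianProduct (x ∷ xs) ys = trans (length-++ (map (x ,_) ys))
  (cong₂ _+_ (length-map (x ,_) ys) (length-cartesianProduct xs ys))

length-concatMap : (f : A → List B) (xs : List A) → length (concatMap f xs) ≡ ∑ xs (length ∘ f)
length-concatMap f []       = refl
length-concatMap f (x ∷ xs) = trans (length-++ (f x)) (cong (length (f x) +_) (length-concatMap f xs))

length-allFin : ∀ m → length (allFin m) ≡ m
length-allFin m = length-tabulate id

∑-suc : ∀ {m} (f : Fin (suc m) → ℕ) → ∑ (allFin (suc m)) f ≡ f zero + ∑ (allFin m) (f ∘ suc)
∑-suc f = cong (λ xs → f zero + sum xs) (trans (map-tabulate suc f) (sym (map-tabulate id (f ∘ suc))))

∑-punchIn : ∀ {m} (i : Fin (suc m)) (f : Fin (suc m) → ℕ) →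
            ∑ (allFin (suc m)) f ≡ f i + ∑ (allFin m) (f ∘ punchIn i)
∑-punchIn zero f = ∑-suc f
∑-punchIn {suc m} (suc i) f = begin
  ∑ (allFin (suc (suc m))) f                                     ≡⟨ ∑-suc f ⟩
  f zero + ∑ (allFin (suc m)) (f ∘ suc)                          ≡⟨ cong (f zero +_) (∑-punchIn i (f ∘ suc)) ⟩
  f zero + (f (suc i) + ∑ (allFin m) (f ∘ suc ∘ punchIn i))      ≡⟨ x∙yz≈y∙xz (f zero) (f (suc i)) _ ⟩
  f (suc i) + (f zero + ∑ (allFin m) (f ∘ suc ∘ punchIn i))      ≡⟨ cong (f (suc i) +_) (∑-suc (f ∘ punchIn (suc i))) ⟨
  f (suc i) + ∑ (allFin (suc m)) (f ∘ punchIn (suc i))           ∎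
  where
  open ≡-Reasoning

unique-++-disjoint : {xs ys : List A} → Unique (xs ++ ys) → ∀ {x} → x ∈ xs → x ∉ ys
unique-++-disjoint {xs = _ ∷ xs} u (here refl) m = unique-head u (∈-++⁺ʳ xs m)
unique-++-disjoint {xs = _ ∷ xs} u (there p)   m = unique-++-disjoint (unique-tail u) p m

unique-++ʳ : (xs : List A) {ys : List A} → Unique (xs ++ ys) → Unique ys
unique-++ʳ []       u = u
unique-++ʳ (_ ∷ xs) u = unique-++ʳ xs (unique-tail u)

∈-concatMap : (f : A → List B) {xs : List A} {x : A} {y : B} → x ∈ xs → y ∈ f x → y ∈ concatMap f xs
∈-concatMap f m p = ∈-concatMap⁺ f (lose m p)

unique-concatMap : (f : A → List B) {xs : List A} → Unique (concatMap f xs) →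
                   ∀ {x y z} → x ∈ xs → y ∈ xs → z ∈ f x → z ∈ f y → x ≡ y
unique-concatMap f u (here refl) (here refl) p q = refl
unique-concatMap f u (here refl) (there n)   p q = contradiction (∈-concatMap f n q) (unique-++-disjoint u p)
unique-concatMap f u (there m)   (here refl) p q = contradiction (∈-concatMap f m p) (unique-++-disjoint u q)
unique-concatMap f {x ∷ xs} u (there m) (there n) p q = unique-concatMap f (unique-++ʳ (f x) u) m n p q

module _ {N : ℕ} where

  open DecMem {A = Fin N} _≟_ using (_∈?_)

  compress : (xs : List (Fin N)) → ∃[ ys ] Unique ys × xs ⊑ ys × length ys ≤ length xs
  compress []       = [] , [] , (λ ()) , z≤n
  compress (x ∷ xs) with compress xs
  ... | ys , u , s , le with x ∈? ys
  ... | yes x∈ = ys , u , (λ { (here refl) → x∈ ; (there m) → s m }) , m≤n⇒m≤1+n le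
  ... | no x∉  = x ∷ ys , unique-cons x∉ u , (λ { (here refl) → here refl ; (there m) → there (s m) }) , s≤s le

  unique-or-shorter : (xs : List (Fin N)) → Unique xs ⊎ (∃[ ys ] xs ⊑ ys × length ys < length xs)
  unique-or-shorter []       = inj₁ []
  unique-or-shorter (x ∷ xs) with x ∈? xs
  ... | yes x∈ = inj₂ (xs , (λ { (here refl) → x∈ ; (there m) → m }) , ≤-refl)
  ... | no x∉ with unique-or-shorter xs
  ...   | inj₁ u             = inj₁ (unique-cons x∉ u)
  ...   | inj₂ (ys , s , lt) = inj₂ (x ∷ ys , (λ { (here refl) → here refl ; (there m) → there (s m) }) , s≤s lt)

  outside : ∀ {m} (xs : List (Fin N)) → length xs + m ≤ N →
            Σ (Fin m → Fin N) λ f → (∀ {i j} → f i ≡ f j → i ≡ j) × (∀ i → f i ∉ xs)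
  outside {m} xs le = (λ i → lookup co (inject≤ i m≤)) , (λ e → inject≤-injective m≤ m≤ _ _ (lookup-injective uco e))
                    , λ i → proj₂ (∈-filter⁻ (λ x → ¬? (x ∈? xs)) {xs = allFin N} (∈-lookup (inject≤ i m≤)))
    where
    co = filter (λ x → ¬? (x ∈? xs)) (allFin N)
    uco : Unique co
    uco = Uniq.filter⁺ _ (Uniq.allFin⁺ N)
    split : allFin N ⊑ xs ++ co
    split {x} m with x ∈? xs
    ... | yes x∈ = ∈-++⁺ˡ x∈
    ... | no x∉  = ∈-++⁺ʳ xs (∈-filter⁺ _ m x∉)
    m≤ : m ≤ length co
    m≤ = +-cancelˡ-≤ (length xs) _ _ (begin
      length xs + m         ≤⟨ le ⟩
      N                     ≡⟨ length-allFin N ⟨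
      length (allFin N)     ≤⟨ unique-⊑⇒length≤ (Uniq.allFin⁺ N) split ⟩
      length (xs ++ co)     ≡⟨ length-++ xs ⟩
      length xs + length co ∎)
      where open ≤-Reasoning

  pad : ∀ {e} (xs : List (Fin N)) → Unique xs → length xs + e ≤ N →
        ∃[ ys ] Unique ys × xs ⊑ ys × length ys ≡ e + length xs
  pad {e} xs u le with outside xs le
  ... | f , inj , f∉ = tabulate f ++ xs
    , Uniq.++⁺ (Uniq.tabulate⁺ inj) u (λ (m₁ , m₂) → let i , eq = ∈-tabulate⁻ m₁ in f∉ i (subst (_∈ xs) eq m₂))
    , ∈-++⁺ʳ (tabulate f)
    , trans (length-++ (tabulate f)) (cong (_+ length xs) (length-tabulate f))

module Sparse {c′ N : ℕ} (q : ℕ) (χ : Colouring (suc c′) N) where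

  c s r : ℕ
  c = suc c′
  s = c′ + q
  r = suc (suc s)

  open Codegree r χ
  open DecMem {A = Fin N} _≟_ using (_∈?_)

  V : Set
  V = Fin N

  infix 4 _spans_
  _spans_ : List V → Fin c → Set
  W spans i = ∃[ x ] ∃[ y ] x ∈ W × y ∈ W × Bad i x y

  spans-⊑ : ∀ {W W′ i} → W ⊑ W′ → W spans i → W′ spans i
  spans-⊑ sub (x , y , x∈ , y∈ , b) = x , y , sub x∈ , sub y∈ , b

  module _ (d : ℕ) (C≡ : r C 2 ≡ suc d) where

    -- Every r-set S f ∪ {A u} ∪ {x} with x outside S f ∪ A contains a bad pair of its own
    -- colour taken from Q, and a bad pair lies in at most d edges of its colour.
    family-bound : ∀ {b a m} (S : Fin b → List V) (A : Fin a → V) (Q : List (Fin c × V × V)) →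
      (∀ {u w} → A u ≡ A w → u ≡ w) →
      (∀ f → Unique (S f)) → (∀ f → length (S f) ≡ s) → (∀ f u → A u ∉ S f) →
      (∀ {f g} → f ≢ g → ∃[ y ] ∃[ z ] y ≢ z × (y ∈ S g × z ∈ S g) × (y ∉ S f × z ∉ S f)) →
      (∀ {i x y} → (i , x , y) ∈ Q → Bad i x y) →
      (∀ f u i → ∃[ x ] ∃[ y ] (i , x , y) ∈ Q × x ∈ A u ∷ S f × y ∈ A u ∷ S f) →
      s + a + m ≤ N → b * (a * m) ≤ length Q * d
    family-bound {b} {a} {m} S A Q A-inj uS lenS A∉ sep bad cover room = begin
      b * (a * m)     ≡⟨ lenXs ⟨
      length Xs       ≡⟨ *-identityʳ _ ⟨
      length Xs * 1   ≤⟨ double-counting edge?′ Xs Q lo hi ⟩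
      length Q * d    ∎
      where
      open ≤-Reasoning
      AS : Fin b → List V
      AS f = S f ++ tabulate A
      room′ : ∀ f → length (AS f) + m ≤ N
      room′ f = subst (λ l → l + m ≤ N) (sym (trans (length-++ (S f)) (cong₂ _+_ (lenS f) (length-tabulate A)))) room
      rest : Fin b → Fin m → V
      rest f = proj₁ (outside (AS f) (room′ f))
      rest-inj : ∀ f {x y} → rest f x ≡ rest f y → x ≡ y
      rest-inj f = proj₁ (proj₂ (outside (AS f) (room′ f)))
      rest∉S : ∀ f x → rest f x ∉ S f
      rest∉S f x m = proj₂ (proj₂ (outside (AS f) (room′ f))) x (∈-++⁺ˡ m)
      rest≢A : ∀ f x u → rest f x ≢ A u
      rest≢A f x u e = proj₂ (proj₂ (outside (AS f) (room′ f))) x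
        (∈-++⁺ʳ (S f) (subst (_∈ tabulate A) (sym e) (∈-tabulate⁺ u)))
      I = Fin b × Fin a × Fin m
      xs : I → List V
      xs (f , u , x) = rest f x ∷ A u ∷ S f
      X : I → Subset N
      X t = fromList (xs t)
      X-⊑ : ∀ {t t′} → X t ≡ X t′ → xs t ⊑ xs t′
      X-⊑ {t′ = t′} e m = ∈-fromList⁻ (xs t′) (subst (_ ∈ˢ_) e (∈-fromList⁺ m))
      same-u : ∀ {f u x f′ u′ x′} → xs (f , u , x) ⊑ xs (f′ , u′ , x′) → u ≡ u′
      same-u {u = u} {x} {f′} {u′} {x′} sub with sub (there (here refl))
      ... | here e          = contradiction (sym e) (rest≢A f′ x′ u)
      ... | there (here e)  = A-inj e
      ... | there (there m) = contradiction m (A∉ f′ u)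
      new≡rest : ∀ {f u x f′ u′ x′ y} → xs (f′ , u′ , x′) ⊑ xs (f , u , x) → y ∈ S f′ → y ∉ S f → y ≡ rest f x
      new≡rest {f} {u} {f′ = f′} sub y∈ y∉ with sub (there (there y∈))
      ... | here e            = e
      ... | there (here refl) = contradiction y∈ (A∉ f′ u)
      ... | there (there m)   = contradiction m y∉
      same-f : ∀ {f u x f′ u′ x′} → xs (f′ , u′ , x′) ⊑ xs (f , u , x) → f ≡ f′
      same-f {f} {f′ = f′} sub with f ≟ f′
      ... | yes e = e
      ... | no f≢ with sep f≢
      ...   | y , z , y≢z , (y∈ , z∈) , (y∉ , z∉) =
        contradiction (trans (new≡rest sub y∈ y∉) (sym (new≡rest sub z∈ z∉))) y≢z
      same-x : ∀ {f u x x′} → xs (f , u , x) ⊑ xs (f , u , x′) → x ≡ x′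
      same-x {f} {u} {x} sub with sub (here refl)
      ... | here e          = rest-inj f e
      ... | there (here e)  = contradiction e (rest≢A f x u)
      ... | there (there m) = contradiction m (rest∉S f x)
      X-inj : ∀ {t t′} → X t ≡ X t′ → t ≡ t′
      X-inj {t@(f , u , x)} {t′@(f′ , u′ , x′)} e with same-f {f} {u} {x} {f′} {u′} {x′} (X-⊑ {t′} {t} (sym e))
      ... | refl with same-u {f} {u} {x} {f} {u′} {x′} (X-⊑ {t} {t′} e)
      ... | refl with same-x {f} {u} {x} {x′} (X-⊑ {t} {t′} e)
      ... | refl = refl
      Is = cartesianProduct (allFin b) (cartesianProduct (allFin a) (allFin m))
      Xs = map X Is
      uXs : Unique Xs
      uXs = Uniq.map⁺ X-inj (Uniq.cartesianProduct⁺ (Uniq.allFin⁺ b) (Uniq.cartesianProduct⁺ (Uniq.allFin⁺ a) (Uniq.allFin⁺ m)))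
      lenXs : length Xs ≡ b * (a * m)
      lenXs = trans (length-map X Is) (trans (length-cartesianProduct (allFin b) _)
        (cong₂ _*_ (length-allFin b) (trans (length-cartesianProduct (allFin a) (allFin m))
          (cong₂ _*_ (length-allFin a) (length-allFin m)))))
      edge?′ : ∀ Y (t : Fin c × V × V) → Dec (Edge (proj₁ t) (proj₁ (proj₂ t)) (proj₂ (proj₂ t)) Y)
      edge?′ Y (i , x , y) = edge? i x y Y
      size : ∀ t → Unique (xs t)
      size (f , u , x) = unique-cons (λ { (here e) → rest≢A f x u e ; (there m) → rest∉S f x m })
                           (unique-cons (A∉ f u) (uS f))
      lo : ∀ {Y} → Y ∈ Xs → 1 ≤ length (filter (edge?′ Y) Q)
      lo m with ∈-map⁻ X m
      ... | t@(f , u , x) , _ , refl with cover f u (χ (X t))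
      ...   | y , z , q∈ , y∈ , z∈ = ∈-length (∈-filter⁺ (edge?′ (X t)) q∈
        (trans (∣fromList∣ (size t)) (cong (λ l → suc (suc l)) (lenS f)) , refl , ∈-fromList⁺ (there y∈) , ∈-fromList⁺ (there z∈)))
      hi : ∀ {t} → t ∈ Q → length (filter (λ Y → edge?′ Y t) Xs) ≤ d
      hi {i , x , y} q∈ = ≤-trans
        (unique-⊑⇒length≤ (Uniq.filter⁺ _ uXs) λ m → ∈-edges⁺ (proj₂ (∈-filter⁻ (λ Y → edge?′ Y (i , x , y)) {xs = Xs} m)))
        (s≤s⁻¹ (subst (length (edges i x y) <_) C≡ (proj₂ (bad q∈))))

    no-small-rainbow : ∀ {m} → s + 2 * c + m ≤ N → c * d < 2 * c * m →
                       ∀ {W} → length W ≤ s → ¬ (∀ i → W spans i)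
    no-small-rainbow {m} room big {W} W≤ rainbow with compress W
    ... | W₁ , u₁ , W⊑ , le₁ with pad {e = s ∸ length W₁} W₁ u₁ (≤-trans (≤-reflexive (m+[n∸m]≡n (≤-trans le₁ W≤)))
                                        (≤-trans (m≤m+n s (2 * c)) (≤-trans (m≤m+n _ m) room)))
    ... | S , uS , W₁⊑ , lenS′ with outside {m = 2 * c} S (≤-trans (≤-reflexive (cong (_+ 2 * c) (trans lenS′ (m∸n+n≡m (≤-trans le₁ W≤)))))
                                        (≤-trans (m≤m+n _ m) room))
    ... | A , A-inj , A∉ = <⇒≱ big (begin
        2 * c * m        ≡⟨ +-identityʳ _ ⟨
        1 * (2 * c * m)  ≤⟨ family-bound {b = 1} (λ _ → S) A Q A-inj (λ _ → uS) (λ _ → trans lenS′ (m∸n+n≡m (≤-trans le₁ W≤))) (λ _ → A∉)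
                              (λ { {zero} {zero} f≢ → contradiction refl f≢ }) bad cover room ⟩
        length Q * d     ≡⟨ cong (_* d) (trans (length-map triple (allFin c)) (length-allFin c)) ⟩
        c * d            ∎)
      where
      open ≤-Reasoning
      triple : Fin c → Fin c × V × V
      triple i = i , proj₁ (rainbow i) , proj₁ (proj₂ (rainbow i))
      Q = map triple (allFin c)
      bad : ∀ {i x y} → (i , x , y) ∈ Q → Bad i x y
      bad m with ∈-map⁻ triple m
      ... | i , _ , refl = proj₂ (proj₂ (proj₂ (proj₂ (rainbow i))))
      cover : ∀ (f : Fin 1) u i → ∃[ x ] ∃[ y ] (i , x , y) ∈ Q × x ∈ A u ∷ S × y ∈ A u ∷ S
      cover _ u i = let x , y , x∈ , y∈ , _ = rainbow i in
        x , y , ∈-map⁺ triple (∈-allFin i) , there (W₁⊑ (W⊑ x∈)) , there (W₁⊑ (W⊑ y∈))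

    module _ (n′ : ℕ) (sparse : ∀ i {xs} → AllPairs (Good i) xs → length xs < suc n′) where

      good : ∀ {i x y} → x ≢ y → ¬ Bad i x y → Good i x y
      good x≢y ¬bad = x≢y , ≮⇒≥ (λ lt → ¬bad (x≢y , lt))

      good-or-bad : ∀ i {xs} → Unique xs → AllPairs (Good i) xs ⊎ xs spans i
      good-or-bad i {[]}     u = inj₁ []
      good-or-bad i {x ∷ xs} u with Any.any? (bad? i x) xs
      ... | yes found = let y , y∈ , b = find found in inj₂ (x , y , here refl , there y∈ , b)
      ... | no none with good-or-bad i (unique-tail u)
      ...   | inj₂ sp = inj₂ (spans-⊑ there sp)
      ...   | inj₁ ap = inj₁ (All.tabulate (λ y∈ → good (λ { refl → unique-head u y∈ }) (λ b → none (lose y∈ b))) ∷ ap)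

      long-spans : ∀ i {xs} → Unique xs → suc n′ ≤ length xs → xs spans i
      long-spans i u le with good-or-bad i u
      ... | inj₁ ap = contradiction le (<⇒≱ (sparse i ap))
      ... | inj₂ sp = sp

      ends : V × V → List V
      ends (x , y) = x ∷ y ∷ []

      record BadMatching (i : Fin c) (b : ℕ) (xs : List V) : Set where
        field
          edge     : Fin b → V × V
          bad      : ∀ f → Bad i (proj₁ (edge f)) (proj₂ (edge f))
          disjoint : ∀ {f g} → f ≢ g → ∀ {x} → x ∈ ends (edge f) → x ∉ ends (edge g)
          within   : ∀ f → ends (edge f) ⊑ xs

      bad-matching : ∀ i b {xs} → Unique xs → suc n′ + 2 * b ≤ length xs → BadMatching i (suc b) xs
      bad-matching i b {xs} u le with long-spans i u (m+n≤o⇒m≤o (suc n′) le)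
      bad-matching i zero {xs} u le | x , y , x∈ , y∈ , xy = record
        { edge     = λ _ → x , y
        ; bad      = λ _ → xy
        ; disjoint = λ { {zero} {zero} f≢ → contradiction refl f≢ }
        ; within   = λ { _ (here refl) → x∈ ; _ (there (here refl)) → y∈ } }
      bad-matching i (suc b) {xs} u le | x , y , x∈ , y∈ , xy = record
        { edge     = λ { zero → x , y ; (suc f) → edge f }
        ; bad      = λ { zero → xy ; (suc f) → bad f }
        ; disjoint = λ { {zero} {zero} f≢ → contradiction refl f≢
                       ; {zero} {suc g} _ m m′ → avoid g m′ m
                       ; {suc f} {zero} _ m m′ → avoid f m m′
                       ; {suc f} {suc g} f≢ → disjoint (f≢ ∘ cong suc) }
        ; within   = λ { zero (here refl) → x∈ ; zero (there (here refl)) → y∈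
                       ; (suc f) m → proj₁ (∈-filter⁻ out? {xs = xs} (within f m)) } }
        where
        out? = λ z → ¬? (z ∈? ends (x , y))
        xs′ = filter out? xs
        split : xs ⊑ x ∷ y ∷ xs′
        split {z} m with z ∈? ends (x , y)
        ... | yes (here e)         = here e
        ... | yes (there (here e)) = there (here e)
        ... | no z∉                = there (there (∈-filter⁺ out? m z∉))
        le′ : suc n′ + 2 * b ≤ length xs′
        le′ = +-cancelˡ-≤ 2 _ _ (begin
          2 + (suc n′ + 2 * b)   ≡⟨ x∙yz≈y∙xz 2 (suc n′) (2 * b) ⟩
          suc n′ + (2 + 2 * b)   ≡⟨ cong (suc n′ +_) (*-suc 2 b) ⟨
          suc n′ + 2 * suc b     ≤⟨ le ⟩
          length xs              ≤⟨ unique-⊑⇒length≤ u split ⟩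
          2 + length xs′         ∎)
          where
          open ≤-Reasoning
        open BadMatching (bad-matching i b (Uniq.filter⁺ out? u) le′)
        avoid : ∀ f {z} → z ∈ ends (edge f) → z ∉ ends (x , y)
        avoid f m = proj₂ (∈-filter⁻ out? {xs = xs} (within f m))

      badNbrs : Fin c → V → List V
      badNbrs i v = filter (bad? i v) (allFin N)

      unique-badNbrs : ∀ i v → Unique (badNbrs i v)
      unique-badNbrs i v = Uniq.filter⁺ (bad? i v) (Uniq.allFin⁺ N)

      ∈-badNbrs⁻ : ∀ {i v x} → x ∈ badNbrs i v → Bad i v x
      ∈-badNbrs⁻ {i} {v} m = proj₂ (∈-filter⁻ (bad? i v) {xs = allFin N} m)

      ∈-badNbrs⁺ : ∀ {i v x} → Bad i v x → x ∈ badNbrs i v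
      ∈-badNbrs⁺ {i} {v} {x} = ∈-filter⁺ (bad? i v) (∈-allFin x)

      degree : Fin c → V → ℕ
      degree i v = length (badNbrs i v)

      isolated : ℕ → ℕ
      isolated zero    = 1
      isolated (suc _) = 0

      isolated-positive : ∀ {m e} → m < e → isolated e ≡ 0
      isolated-positive (s≤s _) = refl

      isolated≤1 : ∀ e → isolated e ≤ 1
      isolated≤1 zero    = ≤-refl
      isolated≤1 (suc _) = z≤n

      module _ (k : ℕ) where

        -- a coarse integral version of the Caro–Wei weight (k + 1) / (degree + 1)
        weight : ℕ → ℕ
        weight zero    = suc k
        weight (suc e) with suc e ≤? k
        ... | yes _ = 1
        ... | no _  = 0

        weight-suc≤1 : ∀ e → weight (suc e) ≤ 1
        weight-suc≤1 e with suc e ≤? k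
        ... | yes _ = ≤-refl
        ... | no _  = z≤n

        weight-bounded : ∀ e → weight e ≡ 0 ⊎ weight e + e ≤ suc k
        weight-bounded zero = inj₂ (≤-reflexive (+-identityʳ (suc k)))
        weight-bounded (suc e) with suc e ≤? k
        ... | yes le = inj₂ (s≤s le)
        ... | no _   = inj₁ refl

        weight≥isolated : ∀ e → suc k * isolated e ≤ weight e
        weight≥isolated zero    = ≤-reflexive (*-identityʳ (suc k))
        weight≥isolated (suc e) = subst (_≤ weight (suc e)) (sym (*-zeroʳ k)) z≤n

        light⇒degree>k : ∀ e → weight e < k * isolated e + 1 → k < e
        light⇒degree>k zero lt = contradiction (≤-reflexive (trans (cong (_+ 1) (*-identityʳ k)) (+-comm k 1))) (<⇒≱ lt)
        light⇒degree>k (suc e) lt with suc e ≤? k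
        ... | yes _ = contradiction (≤-reflexive (cong (_+ 1) (*-zeroʳ k))) (<⇒≱ lt)
        ... | no ≰k = ≰⇒> ≰k

        ∑-filter : (xs : List V) (f : V → ℕ) {P : V → Set} (P? : ∀ x → Dec (P x)) →
                   ∑ xs f ≡ ∑ (filter P? xs) f + ∑ (filter (λ x → ¬? (P? x)) xs) f
        ∑-filter []       f P? = refl
        ∑-filter (x ∷ xs) f P? with P? x
        ... | yes _ = trans (cong (f x +_) (∑-filter xs f P?)) (sym (+-assoc (f x) _ _))
        ... | no _  = trans (cong (f x +_) (∑-filter xs f P?))
          (x∙yz≈y∙xz (f x) (∑ (filter P? xs) f) (∑ (filter (λ y → ¬? (P? y)) xs) f))
  
        greedy : ∀ i fuel xs → length xs ≤ fuel → Unique xs →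
                 ∃[ ys ] ys ⊑ xs × AllPairs (Good i) ys × ∑ xs (weight ∘ degree i) ≤ suc k * length ys
        greedy i fuel       []       le u = [] , (λ ()) , [] , z≤n
        greedy i (suc fuel) (x ∷ xs) (s≤s le) u with weight-bounded (degree i x)
        ... | inj₁ w≡0 = let ys , sub , ap , bd = greedy i fuel xs le (unique-tail u) in
          ys , there ∘ sub , ap , ≤-trans (≤-reflexive (cong (_+ ∑ xs (weight ∘ degree i)) w≡0)) bd
        ... | inj₂ w+e≤ with greedy i fuel (filter (λ y → ¬? (bad? i x y)) xs)
                               (≤-trans (length-filter (λ y → ¬? (bad? i x y)) xs) le) (Uniq.filter⁺ _ (unique-tail u))
        ...   | ys , sub , ap , bd = x ∷ ys , sub′ , All.tabulate good-x ∷ ap , (begin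
          w x + ∑ xs w                                     ≡⟨ cong (w x +_) (∑-filter xs w (bad? i x)) ⟩
          w x + (∑ near w + ∑ far w)                       ≡⟨ +-assoc (w x) _ _ ⟨
          w x + ∑ near w + ∑ far w                         ≤⟨ +-mono-≤ (≤-trans (+-monoʳ-≤ (w x) near≤) w+e≤) bd ⟩
          suc k + suc k * length ys                        ≡⟨ *-suc (suc k) (length ys) ⟨
          suc k * length (x ∷ ys)                          ∎)
          where
          open ≤-Reasoning
          w = weight ∘ degree i
          near = filter (bad? i x) xs
          far  = filter (λ y → ¬? (bad? i x y)) xs
          ∈far : ∀ {y} → y ∈ ys → y ∈ xs × ¬ Bad i x y
          ∈far m = ∈-filter⁻ (λ y → ¬? (bad? i x y)) {xs = xs} (sub m)
          sub′ : x ∷ ys ⊑ x ∷ xs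
          sub′ (here refl) = here refl
          sub′ (there m)   = there (proj₁ (∈far m))
          good-x : ∀ {y} → y ∈ ys → Good i x y
          good-x m = good (λ { refl → unique-head u (proj₁ (∈far m)) }) (proj₂ (∈far m))
          near-weight : ∀ {y} → y ∈ near → w y ≤ 1
          near-weight {y} m with badNbrs i y in eq
          ... | _ ∷ zs = weight-suc≤1 (length zs)
          ... | []     = contradiction (subst (x ∈_) eq
                           (∈-badNbrs⁺ (bad-sym (proj₂ (∈-filter⁻ (bad? i x) {xs = xs} m))))) λ ()
          near≤ : ∑ near w ≤ degree i x
          near≤ = ≤-trans (∑-≤-bound near near-weight) (≤-trans (≤-reflexive (*-identityʳ _))
            (unique-⊑⇒length≤ (Uniq.filter⁺ (bad? i x) (unique-tail u))
              (∈-badNbrs⁺ ∘ proj₂ ∘ ∈-filter⁻ (bad? i x) {xs = xs})))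

        total-weight : ∑ (allFin N) (λ v → ∑ (allFin c) (λ i → weight (degree i v))) ≤ c * (suc k * n′)
        total-weight = begin
          ∑ (allFin N) (λ v → ∑ (allFin c) (λ i → weight (degree i v))) ≡⟨ ∑-comm (allFin N) (allFin c) _ ⟩
          ∑ (allFin c) (λ i → ∑ (allFin N) (weight ∘ degree i))         ≤⟨ ∑-≤-bound (allFin c) (λ {i} _ → per-colour i) ⟩
          length (allFin c) * (suc k * n′)                              ≡⟨ cong (_* (suc k * n′)) (length-allFin c) ⟩
          c * (suc k * n′)                                              ∎
          where
          open ≤-Reasoning
          per-colour : ∀ i → ∑ (allFin N) (weight ∘ degree i) ≤ suc k * n′
          per-colour i = let ys , _ , ap , bd = greedy i _ (allFin N) ≤-refl (Uniq.allFin⁺ N) in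
            ≤-trans bd (*-monoʳ-≤ (suc k) (s≤s⁻¹ (sparse i ap)))

        module _ (c≡ : c ≡ k + q) (n≤N : suc n′ ≤ N)
                 {m₁ : ℕ} (room-small : s + 2 * c + m₁ ≤ N) (count-small : c * d < 2 * c * m₁)
                 {m₂ : ℕ} (room-star : s + suc k + m₂ ≤ N)
                 (count-q≡1 : q ≡ 1 → (suc k + c′) * d < suc k * m₂)
                 {b : ℕ} (room-matching : 2 ≤ q → suc n′ + 2 * b ≤ N)
                 (count-q≥2 : 2 ≤ q → (suc k + (suc b + c′)) * d < suc b * (suc k * m₂))
                 (weight-deficit : c * n′ < N * q) where

          bad-pair : ∀ i → allFin N spans i
          bad-pair i = long-spans i (Uniq.allFin⁺ N) (subst (suc n′ ≤_) (sym (length-allFin N)) n≤N)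

          module Centre (v : V) where

            iso : Fin c → ℕ
            iso i = isolated (degree i v)

            piece-of : ∀ i → ∃[ xs ] v ∷ xs spans i × length xs ≡ suc (iso i)
            piece-of i with badNbrs i v in eq
            ... | u ∷ _ = u ∷ [] , (v , u , here refl , there (here refl) , ∈-badNbrs⁻ (subst (u ∈_) (sym eq) (here refl))) , refl
            ... | [] = let x , y , _ , _ , xy = bad-pair i in
              x ∷ y ∷ [] , (x , y , there (here refl) , there (there (here refl)) , xy) , refl

            piece : Fin c → List V
            piece i = proj₁ (piece-of i)

            piece-spans : ∀ i → v ∷ piece i spans i
            piece-spans i = proj₁ (proj₂ (piece-of i))

            length-pieces : ∀ {e} (P : Fin e → List V) (f : Fin e → ℕ) → (∀ j → length (P j) ≡ suc (f j)) →
                            length (concatMap P (allFin e)) ≡ e + ∑ (allFin e) f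
            length-pieces {e} P f len = begin
              length (concatMap P (allFin e))              ≡⟨ length-concatMap P (allFin e) ⟩
              ∑ (allFin e) (length ∘ P)                    ≡⟨ cong sum (map-cong len (allFin e)) ⟩
              ∑ (allFin e) (λ j → 1 + f j)                 ≡⟨ ∑-+ (allFin e) (λ _ → 1) f ⟩
              ∑ (allFin e) (λ _ → 1) + ∑ (allFin e) f      ≡⟨ cong (_+ ∑ (allFin e) f) (trans (∑-const (allFin e) 1) (trans (*-identityʳ _) (length-allFin e))) ⟩
              e + ∑ (allFin e) f                           ∎
              where open ≡-Reasoning

            ⊑-concatMap : ∀ {e} (P : Fin e → List V) j → v ∷ P j ⊑ v ∷ concatMap P (allFin e)
            ⊑-concatMap P j (here e)  = here e
            ⊑-concatMap P j (there m) = there (∈-concatMap P (∈-allFin j) m)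

            z : ℕ
            z = ∑ (allFin c) iso

            many-isolated : ¬ (suc z < q)
            many-isolated lt = no-small-rainbow room-small count-small {v ∷ concatMap piece (allFin c)}
              (begin
                suc (length (concatMap piece (allFin c))) ≡⟨ cong suc (length-pieces piece iso (λ i → proj₂ (proj₂ (piece-of i)))) ⟩
                suc (c + z)                               ≡⟨ cong suc (+-suc c′ z) ⟨
                suc (c′ + suc z)                          ≡⟨ +-suc c′ (suc z) ⟨
                c′ + suc (suc z)                          ≤⟨ +-monoʳ-≤ c′ lt ⟩
                c′ + q                                    ∎)
              (λ i → spans-⊑ (⊑-concatMap piece i) (piece-spans i))
              where open ≤-Reasoning

            module Heavy (q≡ : q ≡ suc z) (i₀ : Fin c) (k<deg : k < degree i₀ v) where

              others : Fin c′ → Fin c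
              others = punchIn i₀

              leaf : Fin (suc k) → V
              leaf u = lookup (badNbrs i₀ v) (inject≤ u k<deg)

              leaf-bad : ∀ u → Bad i₀ v (leaf u)
              leaf-bad u = ∈-badNbrs⁻ (∈-lookup (inject≤ u k<deg))

              iso-i₀ : iso i₀ ≡ 0
              iso-i₀ = isolated-positive k<deg

              z≡ : z ≡ ∑ (allFin c′) (iso ∘ others)
              z≡ = trans (∑-punchIn i₀ iso) (cong (_+ ∑ (allFin c′) (iso ∘ others)) iso-i₀)

              assemble : ∀ {b} (P : Fin b → Fin c′ → List V) (Q : List (Fin c × V × V)) →
                (∀ f j → length (P f j) ≡ suc (iso (others j))) →
                (∀ {f g} → f ≢ g → Unique (v ∷ concatMap (P f) (allFin c′)) → Unique (v ∷ concatMap (P g) (allFin c′)) →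
                   ∃[ x ] ∃[ y ] x ≢ y × (x ∈ v ∷ concatMap (P g) (allFin c′) × y ∈ v ∷ concatMap (P g) (allFin c′))
                                       × (x ∉ v ∷ concatMap (P f) (allFin c′) × y ∉ v ∷ concatMap (P f) (allFin c′))) →
                (∀ {i x y} → (i , x , y) ∈ Q → Bad i x y) →
                (∀ f j → ∃[ x ] ∃[ y ] (others j , x , y) ∈ Q × x ∈ v ∷ P f j × y ∈ v ∷ P f j) →
                b * (suc k * m₂) ≤ (suc k + length Q) * d
              assemble {b} P Q lenP sep badQ coverQ = subst (λ l → b * (suc k * m₂) ≤ l * d)
                (trans (length-++ star) (cong (_+ length Q) (trans (length-map _ (allFin (suc k))) (length-allFin (suc k)))))
                (family-bound S leaf (star ++ Q) leaf-inj uS lenS (λ f u → unique-head (u∷S f u))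
                  (λ {f} {g} f≢g → sep f≢g (uS f) (uS g)) bad cover room-star)
                where
                S : Fin b → List V
                S f = v ∷ concatMap (P f) (allFin c′)
                spoke : Fin (suc k) → Fin c × V × V
                spoke u = i₀ , v , leaf u
                star = map spoke (allFin (suc k))
                leaf-inj : ∀ {u w} → leaf u ≡ leaf w → u ≡ w
                leaf-inj e = inject≤-injective k<deg k<deg _ _ (lookup-injective (unique-badNbrs i₀ v) e)
                lenS : ∀ f → length (S f) ≡ s
                lenS f = begin
                  suc (length (concatMap (P f) (allFin c′)))   ≡⟨ cong suc (length-pieces (P f) (iso ∘ others) (lenP f)) ⟩
                  suc (c′ + ∑ (allFin c′) (iso ∘ others))      ≡⟨ cong (λ l → suc (c′ + l)) z≡ ⟨
                  suc (c′ + z)                                 ≡⟨ +-suc c′ z ⟨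
                  c′ + suc z                                   ≡⟨ cong (c′ +_) q≡ ⟨
                  c′ + q                                       ∎
                  where open ≡-Reasoning
                bad : ∀ {i x y} → (i , x , y) ∈ star ++ Q → Bad i x y
                bad m with ∈-++⁻ star m
                ... | inj₂ m₂ = badQ m₂
                ... | inj₁ m₁ with ∈-map⁻ spoke m₁
                ...   | u , _ , refl = leaf-bad u
                cover : ∀ f u i → ∃[ x ] ∃[ y ] (i , x , y) ∈ star ++ Q × x ∈ leaf u ∷ S f × y ∈ leaf u ∷ S f
                cover f u i with i₀ ≟ i
                ... | yes refl = v , leaf u , ∈-++⁺ˡ (∈-map⁺ spoke (∈-allFin u)) , there (here refl) , here refl
                ... | no i₀≢i with coverQ f (punchOut i₀≢i)
                ...   | x , y , m , x∈ , y∈ = x , y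
                  , ∈-++⁺ʳ star (subst (λ j → (j , x , y) ∈ Q) (punchIn-punchOut i₀≢i) m)
                  , there (⊑-concatMap (P f) _ x∈) , there (⊑-concatMap (P f) _ y∈)
                u∷S : ∀ f u → Unique (leaf u ∷ S f)
                u∷S f u with unique-or-shorter (leaf u ∷ S f)
                ... | inj₁ uq = uq
                ... | inj₂ (W , sub , lt) = ⊥-elim (no-small-rainbow room-small count-small
                  (≤-trans (s≤s⁻¹ lt) (≤-reflexive (lenS f)))
                  (λ i → let x , y , m , x∈ , y∈ = cover f u i in x , y , sub x∈ , sub y∈ , bad m))
                uS : ∀ f → Unique (S f)
                uS f = unique-tail (u∷S f zero)

              single : Fin c′ → Fin c × V × V
              single j = let x , y , _ = piece-spans (others j) in others j , x , y

              singles : List (Fin c × V × V)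
              singles = map single (allFin c′)

              length-singles : length singles ≡ c′
              length-singles = trans (length-map single (allFin c′)) (length-allFin c′)

              singles-bad : ∀ {i x y} → (i , x , y) ∈ singles → Bad i x y
              singles-bad m with ∈-map⁻ single m
              ... | j , _ , refl = proj₂ (proj₂ (proj₂ (proj₂ (piece-spans (others j)))))

              singles-cover : ∀ j → ∃[ x ] ∃[ y ] (others j , x , y) ∈ singles × x ∈ v ∷ piece (others j) × y ∈ v ∷ piece (others j)
              singles-cover j = let x , y , x∈ , y∈ , _ = piece-spans (others j) in
                x , y , ∈-map⁺ single (∈-allFin j) , x∈ , y∈

              q≢1 : q ≢ 1
              q≢1 q≡1 = <⇒≱ (count-q≡1 q≡1) (subst₂ _≤_ (+-identityʳ _) (cong (λ l → (suc k + l) * d) length-singles)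
                (assemble {1} (λ _ j → piece (others j)) singles (λ _ j → proj₂ (proj₂ (piece-of (others j))))
                  (λ { {zero} {zero} f≢ → contradiction refl f≢ }) singles-bad (λ _ → singles-cover)))

              others-not-isolated : 2 ≤ q → ∀ j₀ → iso (others j₀) ≤ 0
              others-not-isolated 2≤q j₀ with iso (others j₀) in eq
              ... | zero = z≤n
              ... | suc e = contradiction (subst (λ l → suc b * (suc k * m₂) ≤ (suc k + l) * d) lenQ
                      (assemble P (matched ++ singles) lenP sep bad cover)) (<⇒≱ (count-q≥2 2≤q))
                where
                iso≡1 : iso (others j₀) ≡ 1
                iso≡1 = ≤-antisym (isolated≤1 (degree (others j₀) v)) (subst (1 ≤_) (sym eq) (s≤s z≤n))
                open BadMatching (bad-matching (others j₀) b (Uniq.allFin⁺ N) (subst (_ ≤_) (sym (length-allFin N)) (room-matching 2≤q)))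
                  renaming (bad to edge-bad)
                P : Fin (suc b) → Fin c′ → List V
                P f j with j ≟ j₀
                ... | yes _ = ends (edge f)
                ... | no _  = piece (others j)
                S : Fin (suc b) → List V
                S f = v ∷ concatMap (P f) (allFin c′)
                P-j₀ : ∀ f → P f j₀ ≡ ends (edge f)
                P-j₀ f with j₀ ≟ j₀
                ... | yes _ = refl
                ... | no ≢  = contradiction refl ≢
                lenP : ∀ f j → length (P f j) ≡ suc (iso (others j))
                lenP f j with j ≟ j₀
                ... | yes refl = cong suc (sym iso≡1)
                ... | no _     = proj₂ (proj₂ (piece-of (others j)))
                triple : Fin (suc b) → Fin c × V × V
                triple f = others j₀ , edge f
                matched = map triple (allFin (suc b))
                lenQ : length (matched ++ singles) ≡ suc b + c′
                lenQ = trans (length-++ matched) (cong₂ _+_ (trans (length-map triple (allFin (suc b))) (length-allFin (suc b))) length-singles)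
                bad : ∀ {i x y} → (i , x , y) ∈ matched ++ singles → Bad i x y
                bad m with ∈-++⁻ matched m
                ... | inj₂ m₂ = singles-bad m₂
                ... | inj₁ m₁ with ∈-map⁻ triple m₁
                ...   | f , _ , refl = edge-bad f
                cover : ∀ f j → ∃[ x ] ∃[ y ] (others j , x , y) ∈ matched ++ singles × x ∈ v ∷ P f j × y ∈ v ∷ P f j
                cover f j with j ≟ j₀
                ... | yes refl = proj₁ (edge f) , proj₂ (edge f) , ∈-++⁺ˡ (∈-map⁺ triple (∈-allFin f))
                               , there (here refl) , there (there (here refl))
                ... | no _     = let x , y , m , x∈ , y∈ = singles-cover j in x , y , ∈-++⁺ʳ matched m , x∈ , y∈
                apart : ∀ {f g} → f ≢ g → Unique (S g) → ∀ {x} → x ∈ ends (edge g) → x ∉ S f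
                apart {f} {g} f≢g u {x} x∈g m with subst (x ∈_) (sym (P-j₀ g)) x∈g
                apart {f} {g} f≢g u {x} x∈g (here refl) | x∈P = unique-head u (∈-concatMap (P g) (∈-allFin j₀) x∈P)
                apart {f} {g} f≢g u {x} x∈g (there m) | x∈P with find (∈-concatMap⁻ (P f) {xs = allFin c′} m)
                ... | j , j∈ , x∈Pfj with j ≟ j₀ in eqj
                ...   | yes _  = disjoint f≢g x∈Pfj x∈g
                ...   | no j≢ = j≢ (unique-concatMap (P g) (unique-tail u) j∈ (∈-allFin j₀) (subst (x ∈_) (same j≢) x∈Pfj) x∈P)
                  where
                  same : j ≢ j₀ → piece (others j) ≡ P g j
                  same j≢ with j ≟ j₀
                  ... | yes e = contradiction e j≢
                  ... | no _  = refl
                sep : ∀ {f g} → f ≢ g → Unique (S f) → Unique (S g) →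
                      ∃[ x ] ∃[ y ] x ≢ y × (x ∈ S g × y ∈ S g) × (x ∉ S f × y ∉ S f)
                sep {f} {g} f≢g uf ug = proj₁ (edge g) , proj₂ (edge g) , proj₁ (edge-bad g)
                  , (within-S (here refl) , within-S (there (here refl)))
                  , (apart f≢g ug (here refl) , apart f≢g ug (there (here refl)))
                  where
                  within-S : ∀ {x} → x ∈ ends (edge g) → x ∈ S g
                  within-S {x} m = there (∈-concatMap (P g) (∈-allFin j₀) (subst (x ∈_) (sym (P-j₀ g)) m))

              absurd : ⊥
              absurd with q ℕ.≟ 1
              ... | yes q≡1 = q≢1 q≡1
              ... | no q≢1′ = contradiction (subst (2 ≤_) q≡ 2≤q) (<⇒≱ (s≤s (s≤s z≤0)))
                where
                2≤q : 2 ≤ q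
                2≤q = ≤∧≢⇒< (subst (1 ≤_) (sym q≡) (s≤s z≤n)) (q≢1′ ∘ sym)
                z≤0 : z ≤ 0
                z≤0 = subst₂ _≤_ (sym z≡) (*-zeroʳ (length (allFin c′)))
                  (∑-≤-bound (allFin c′) (λ {j} _ → others-not-isolated 2≤q j))

            light-absurd : ¬ (∑ (allFin c) (λ i → weight (degree i v)) < suc k * q)
            light-absurd light = <⇒≱ light (subst (_≤ ∑ (allFin c) (λ i → weight (degree i v))) target
              (∑-mono (allFin c) λ {i} _ → ≮⇒≥ λ lt → Heavy.absurd q≡ i (light⇒degree>k (degree i v) lt)))
              where
              z<q : z < q
              z<q = *-cancelˡ-< (suc k) z q (≤-<-trans (≤-trans (≤-reflexive (sym (∑-*ˡ (allFin c) (suc k) iso)))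
                      (∑-mono (allFin c) λ {i} _ → weight≥isolated (degree i v))) light)
              q≡ : q ≡ suc z
              q≡ = ≤-antisym (≮⇒≥ many-isolated) z<q
              target : ∑ (allFin c) (λ i → k * iso i + 1) ≡ suc k * q
              target = begin
                ∑ (allFin c) (λ i → k * iso i + 1)                            ≡⟨ ∑-+ (allFin c) (λ i → k * iso i) (λ _ → 1) ⟩
                ∑ (allFin c) (λ i → k * iso i) + ∑ (allFin c) (λ _ → 1)       ≡⟨ cong₂ _+_ (∑-*ˡ (allFin c) k iso)
                                                                                   (trans (∑-const (allFin c) 1) (trans (*-identityʳ _) (length-allFin c))) ⟩
                k * z + c                                                     ≡⟨ cong (k * z +_) c≡ ⟩
                k * z + (k + q)                                               ≡⟨ cong (λ l → k * z + (k + l)) q≡ ⟩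
                k * z + (k + suc z)                                           ≡⟨ expand k z ⟩
                suc k * suc z                                                 ≡⟨ cong (suc k *_) q≡ ⟨
                suc k * q                                                     ∎
                where
                open ≡-Reasoning
                expand : ∀ k z → k * z + (k + suc z) ≡ suc k * suc z
                expand = solve-∀

          sparse-absurd : ⊥
          sparse-absurd = <⇒≱ weight-deficit (*-cancelˡ-≤ (suc k) (begin
            suc k * (N * q)                                                     ≡⟨ rotate (suc k) N q ⟩
            N * (suc k * q)                                                     ≡⟨ cong (_* (suc k * q)) (length-allFin N) ⟨
            length (allFin N) * (suc k * q)                                     ≤⟨ ∑-≥-bound (allFin N) (λ {v} _ → ≮⇒≥ (Centre.light-absurd v)) ⟩
            ∑ (allFin N) (λ v → ∑ (allFin c) (λ i → weight (degree i v)))       ≤⟨ total-weight ⟩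
            c * (suc k * n′)                                                    ≡⟨ rotate c (suc k) n′ ⟩
            suc k * (c * n′)                                                    ∎))
            where
            open ≤-Reasoning
            rotate : ∀ x y z → x * (y * z) ≡ y * (x * z)
            rotate = solve-∀

-- Arithmetic

2*C2 : ∀ m → 2 * (suc m C 2) ≡ suc m * m
2*C2 zero    = refl
2*C2 (suc m) = begin
  2 * (suc (suc m) C 2)              ≡⟨ cong (2 *_) (nCk+nC[k+1]≡[n+1]C[k+1] (suc m) 1) ⟨
  2 * (suc m C 1 + suc m C 2)        ≡⟨ cong (λ l → 2 * (l + suc m C 2)) (nC1≡n (suc m)) ⟩
  2 * (suc m + suc m C 2)            ≡⟨ *-distribˡ-+ 2 (suc m) _ ⟩
  2 * suc m + 2 * (suc m C 2)        ≡⟨ cong (2 * suc m +_) (2*C2 m) ⟩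
  2 * suc m + suc m * m              ≡⟨ lem m ⟩
  suc (suc m) * suc m                ∎
  where
  open ≡-Reasoning
  lem : ∀ m → 2 * suc m + suc m * m ≡ suc (suc m) * suc m
  lem = solve-∀

2*⌈n/2⌉≤1+n : ∀ n → 2 * ⌈ n /2⌉ ≤ suc n
2*⌈n/2⌉≤1+n n = begin
  2 * ⌊ suc n /2⌋                      ≡⟨ cong (⌊ suc n /2⌋ +_) (+-identityʳ _) ⟩
  ⌊ suc n /2⌋ + ⌊ suc n /2⌋            ≤⟨ +-monoʳ-≤ ⌊ suc n /2⌋ (⌊n/2⌋≤⌈n/2⌉ (suc n)) ⟩
  ⌊ suc n /2⌋ + ⌈ suc n /2⌉            ≡⟨ ⌊n/2⌋+⌈n/2⌉≡n (suc n) ⟩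
  suc n                                ∎
  where open ≤-Reasoning

n≤2*⌈n/2⌉ : ∀ n → n ≤ 2 * ⌈ n /2⌉
n≤2*⌈n/2⌉ n = begin
  n                                    ≡⟨ ⌊n/2⌋+⌈n/2⌉≡n n ⟨
  ⌊ n /2⌋ + ⌈ n /2⌉                    ≤⟨ +-monoˡ-≤ ⌈ n /2⌉ (⌊n/2⌋≤⌈n/2⌉ n) ⟩
  ⌈ n /2⌉ + ⌈ n /2⌉                    ≡⟨ cong (⌈ n /2⌉ +_) (+-identityʳ _) ⟨
  2 * ⌈ n /2⌉                          ∎
  where open ≤-Reasoning

-- c = k + q, s = r − 2, and r C 2 = suc d.
module Bounds (k′ q′ d n′ N : ℕ) where

  k q c′ c s : ℕ
  k  = suc (suc k′)
  q  = suc q′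
  c′ = suc (k′ + q)
  c  = suc c′
  s  = c′ + q

  module _ (C≡ : 2 * suc d ≡ suc (suc s) * suc s)
           (hyp : q * suc d + c * suc s < c * suc n′)
           (N-max : c * suc n′ < q * suc N) where

    open ≤-Reasoning

    N-large : suc d + suc s + 2 * k ≤ N
    N-large = s≤s⁻¹ (*-cancelˡ-< q _ _ (begin-strict
      q * (suc d + suc s + 2 * k)             ≤⟨ m≤m+n _ (k * k) ⟩
      q * (suc d + suc s + 2 * k) + k * k     ≡⟨ eq k′ q′ d ⟩
      q * suc d + c * suc s                   <⟨ hyp ⟩
      c * suc n′                              <⟨ N-max ⟩
      q * suc N                               ∎))
      where
      eq : ∀ k′ q′ d → let k = suc (suc k′); q = suc q′; c = suc (suc (k′ + q)); s = suc (k′ + q) + q in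
           q * (suc d + suc s + 2 * k) + k * k ≡ q * suc d + c * suc s
      eq = solve-∀

    N-vs-n : suc n′ + (2 + c) < N
    N-vs-n = s≤s⁻¹ (*-cancelˡ-< q _ _ (begin-strict
      q * (suc (suc n′ + (2 + c)))             ≡⟨ eq₁ q (suc n′) c ⟩
      q * (c + 3) + q * suc n′                 ≤⟨ +-monoˡ-≤ (q * suc n′) kn ⟩
      k * suc n′ + q * suc n′                  ≡⟨ *-distribʳ-+ (suc n′) k q ⟨
      c * suc n′                               <⟨ N-max ⟩
      q * suc N                                ∎))
      where
      eq₁ : ∀ q n c → q * suc (n + (2 + c)) ≡ q * (c + 3) + q * n
      eq₁ = solve-∀
      eq₂ : ∀ k′ q′ → let q = suc q′; c = suc (suc (k′ + q)); s = suc (k′ + q) + q in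
            c * (q * (c + 3)) + q * (2 + q′ * q′ + 2 * c * q′ + 3 * q′) ≡ q * (suc (suc s) * suc s)
      eq₂ = solve-∀
      eq₃ : ∀ q d → q * (2 * suc d) ≡ 2 * (q * suc d)
      eq₃ = solve-∀
      eq₄ : ∀ k c n → k * (c * n) ≡ c * (k * n)
      eq₄ = solve-∀
      kn : q * (c + 3) ≤ k * suc n′
      kn = *-cancelˡ-≤ c (begin
        c * (q * (c + 3))                      ≤⟨ m≤m+n _ _ ⟩
        c * (q * (c + 3)) + q * (2 + q′ * q′ + 2 * c * q′ + 3 * q′) ≡⟨ eq₂ k′ q′ ⟩
        q * (suc (suc s) * suc s)              ≡⟨ cong (q *_) C≡ ⟨
        q * (2 * suc d)                        ≡⟨ eq₃ q d ⟩
        2 * (q * suc d)                        ≤⟨ *-mono-≤ {2} {k} (s≤s (s≤s z≤n)) (≤-trans (m≤m+n (q * suc d) (c * suc s)) (<⇒≤ hyp)) ⟩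
        k * (c * suc n′)                       ≡⟨ eq₄ k c (suc n′) ⟩
        c * (k * suc n′)                       ∎)

    n≤N : suc n′ ≤ N
    n≤N = ≤-trans (m≤m+n (suc n′) _) (<⇒≤ N-vs-n)

    m₁ : ℕ
    m₁ = suc (suc d) ∸ 2 * q

    C-vs-q : 4 * q ≤ 2 + suc d
    C-vs-q = *-cancelˡ-≤ 2 (begin
      2 * (4 * q)                  ≤⟨ m≤m+n _ _ ⟩
      2 * (4 * q) + (k′ * k′ + 9 * k′ + 4 * k′ * q′ + 4 * q′ * q′ + 10 * q′ + 16) ≡⟨ eq₁ k′ q′ ⟩
      4 + suc (suc s) * suc s      ≡⟨ cong (4 +_) C≡ ⟨
      4 + 2 * suc d                ≡⟨ *-distribˡ-+ 2 2 (suc d) ⟨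
      2 * (2 + suc d)              ∎)
      where
      eq₁ : ∀ k′ q′ → let q = suc q′; s = suc (k′ + q) + q in
        2 * (4 * q) + (k′ * k′ + 9 * k′ + 4 * k′ * q′ + 4 * q′ * q′ + 10 * q′ + 16) ≡ 4 + suc (suc s) * suc s
      eq₁ = solve-∀

    m₁+2q : 2 * q + m₁ ≡ suc (suc d)
    m₁+2q = m+[n∸m]≡n {2 * q} (*-cancelˡ-≤ 2 (begin
      2 * (2 * q)         ≡⟨ *-assoc 2 2 q ⟨
      4 * q               ≤⟨ C-vs-q ⟩
      2 + suc d           ≤⟨ m≤m+n _ _ ⟩
      2 + suc d + suc d   ≡⟨ eq d ⟩
      2 * suc (suc d)     ∎))
      where
      eq : ∀ d → 2 + suc d + suc d ≡ 2 * suc (suc d)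
      eq = solve-∀

    room-small : s + 2 * c + m₁ ≤ N
    room-small = begin
      s + 2 * c + m₁                ≡⟨ eq₁ s k′ q m₁ ⟩
      s + 2 * k + (2 * q + m₁)      ≡⟨ cong (s + 2 * k +_) m₁+2q ⟩
      s + 2 * k + suc (suc d)       ≡⟨ eq₂ s k d ⟩
      suc d + suc s + 2 * k         ≤⟨ N-large ⟩
      N                             ∎
      where
      eq₁ : ∀ s k′ q m → s + 2 * suc (suc (k′ + q)) + m ≡ s + 2 * suc (suc k′) + (2 * q + m)
      eq₁ = solve-∀
      eq₂ : ∀ s k d → s + 2 * k + suc (suc d) ≡ suc d + suc s + 2 * k
      eq₂ = solve-∀

    count-small : c * d < 2 * c * m₁
    count-small = begin-strict
      c * d              <⟨ *-monoʳ-< c (n<1+n d) ⟩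
      c * suc d          ≤⟨ *-monoʳ-≤ c C≤2m₁ ⟩
      c * (2 * m₁)       ≡⟨ eq c m₁ ⟩
      2 * c * m₁         ∎
      where
      eq : ∀ c m → c * (2 * m) ≡ 2 * c * m
      eq = solve-∀
      eq₁ : ∀ d → suc d + (2 + suc d) ≡ 2 * suc (suc d)
      eq₁ = solve-∀
      eq₂ : ∀ q m → 2 * (2 * q + m) ≡ 2 * m + 4 * q
      eq₂ = solve-∀
      C≤2m₁ : suc d ≤ 2 * m₁
      C≤2m₁ = +-cancelʳ-≤ (4 * q) _ _ (begin
        suc d + 4 * q           ≤⟨ +-monoʳ-≤ (suc d) C-vs-q ⟩
        suc d + (2 + suc d)     ≡⟨ eq₁ d ⟩
        2 * suc (suc d)         ≡⟨ cong (2 *_) m₁+2q ⟨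
        2 * (2 * q + m₁)        ≡⟨ eq₂ q m₁ ⟩
        2 * m₁ + 4 * q          ∎)

    m₂ : ℕ
    m₂ = N ∸ (s + suc k)

    m₂-large : suc d ≤ m₂
    m₂-large = begin
      suc d                                ≡⟨ m+n∸m≡n (s + suc k) (suc d) ⟨
      s + suc k + suc d ∸ (s + suc k)      ≤⟨ ∸-monoˡ-≤ (s + suc k) (≤-trans (m≤m+n (s + suc k + suc d) k) (≤-trans (≤-reflexive (eq s k d)) N-large)) ⟩
      N ∸ (s + suc k)                      ∎
      where
      eq : ∀ s k d → s + suc k + suc d + k ≡ suc d + suc s + 2 * k
      eq = solve-∀

    room-star : s + suc k + m₂ ≤ N
    room-star = ≤-reflexive (m+[n∸m]≡n (≤-trans (m≤m+n (s + suc k) (suc d + k)) (≤-trans (≤-reflexive (eq s k d)) N-large)))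
      where
      eq : ∀ s k d → s + suc k + (suc d + k) ≡ suc d + suc s + 2 * k
      eq = solve-∀

    b : ℕ
    b = ⌈ c /2⌉

    room-matching : suc n′ + 2 * b ≤ N
    room-matching = ≤-trans (+-monoʳ-≤ (suc n′) (≤-trans (2*⌈n/2⌉≤1+n c) (n≤1+n (suc c)))) (<⇒≤ N-vs-n)

    count-q≥2 : (suc k + (suc b + c′)) * d < suc b * (suc k * m₂)
    count-q≥2 = begin-strict
      (suc k + (suc b + c′)) * d     ≤⟨ *-monoˡ-≤ d coeff ⟩
      (suc b * suc k) * d            <⟨ *-monoʳ-< (suc b * suc k) (n<1+n d) ⟩
      (suc b * suc k) * suc d        ≤⟨ *-monoʳ-≤ (suc b * suc k) m₂-large ⟩
      (suc b * suc k) * m₂           ≡⟨ *-assoc (suc b) (suc k) m₂ ⟩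
      suc b * (suc k * m₂)           ∎
      where
      eq₁ : ∀ k b c′ → suc k + (suc b + c′) ≡ suc k + b + suc c′
      eq₁ = solve-∀
      eq₂ : ∀ k b → suc k + b + k * b ≡ suc b * suc k
      eq₂ = solve-∀
      coeff : suc k + (suc b + c′) ≤ suc b * suc k
      coeff = begin
        suc k + (suc b + c′)   ≡⟨ eq₁ k b c′ ⟩
        suc k + b + c          ≤⟨ +-monoʳ-≤ (suc k + b) (≤-trans (n≤2*⌈n/2⌉ c) (*-monoˡ-≤ b {2} {k} (s≤s (s≤s z≤n)))) ⟩
        suc k + b + k * b      ≡⟨ eq₂ k b ⟩
        suc b * suc k          ∎

    weight-deficit : c * n′ < N * q
    weight-deficit = +-cancelʳ-< q _ _ (begin-strict
      c * n′ + q        ≤⟨ +-monoʳ-≤ (c * n′) (m≤n+m q k) ⟩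
      c * n′ + c        ≡⟨ eq c n′ ⟩
      c * suc n′        <⟨ N-max ⟩
      q * suc N         ≡⟨ eq′ q N ⟩
      N * q + q         ∎)
      where
      eq : ∀ c n → c * n + c ≡ c * suc n
      eq = solve-∀
      eq′ : ∀ q N → q * suc N ≡ N * q + q
      eq′ = solve-∀

    -- For q = 1 there is no matching to vary and m₂ ≥ r C 2 is too weak: the room comes from c (r − 1) in hyp.
    count-q≡1 : q ≡ 1 → (suc k + c′) * d < suc k * m₂
    count-q≡1 refl = *-cancelˡ-< 2 _ _ (begin-strict
      2 * ((suc k + c′) * d)                             ≡⟨ eq₁ k′ d ⟩
      (2 * k′ + 5) * (2 * d)                             ≡⟨ cong ((2 * k′ + 5) *_) 2d ⟩
      (2 * k′ + 5) * (k′ * k′ + 9 * k′ + 18)             <⟨ m<m+n _ {suc _} (s≤s z≤n) ⟩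
      (2 * k′ + 5) * (k′ * k′ + 9 * k′ + 18) + suc (11 + 10 * k′ + 5 * k′ * k′ + k′ * k′ * k′) ≡⟨ eq₂ k′ ⟩
      (k′ + 3) * (k′ * k′ + 9 * k′ + 18 + 2 * e)         ≡⟨ cong (λ l → (k′ + 3) * (l + 2 * e)) 2d ⟨
      (k′ + 3) * (2 * d + 2 * e)                         ≡⟨ eq₃ k′ d e ⟩
      2 * (suc k * (d + e))                              ≤⟨ *-monoʳ-≤ 2 (*-monoʳ-≤ (suc k) m₂≥) ⟩
      2 * (suc k * m₂)                                   ∎)
      where
      e : ℕ
      e = k′ * k′ + 5 * k′ + 8
      eq₁ : ∀ k′ d → 2 * ((suc (suc (suc k′)) + suc (k′ + 1)) * d) ≡ (2 * k′ + 5) * (2 * d)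
      eq₁ = solve-∀
      eq₂ : ∀ k′ → (2 * k′ + 5) * (k′ * k′ + 9 * k′ + 18) + suc (11 + 10 * k′ + 5 * k′ * k′ + k′ * k′ * k′)
                   ≡ (k′ + 3) * (k′ * k′ + 9 * k′ + 18 + 2 * (k′ * k′ + 5 * k′ + 8))
      eq₂ = solve-∀
      eq₃ : ∀ k′ d e → (k′ + 3) * (2 * d + 2 * e) ≡ 2 * (suc (suc (suc k′)) * (d + e))
      eq₃ = solve-∀
      eq₄ : ∀ d → 2 * d + 2 ≡ 2 * suc d
      eq₄ = solve-∀
      eq₅ : ∀ k′ → let s = suc (k′ + 1) + 1 in suc (suc s) * suc s ≡ k′ * k′ + 9 * k′ + 18 + 2
      eq₅ = solve-∀
      eq₆ : ∀ k′ d → let s = suc (k′ + 1) + 1 in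
            s + suc (suc (suc k′)) + (d + (k′ * k′ + 5 * k′ + 8)) ≡ suc (1 * suc d + suc (suc (k′ + 1)) * suc s)
      eq₆ = solve-∀
      2d : 2 * d ≡ k′ * k′ + 9 * k′ + 18
      2d = +-cancelʳ-≡ 2 _ _ (trans (eq₄ d) (trans C≡ (eq₅ k′)))
      m₂≥ : d + e ≤ m₂
      m₂≥ = begin
        d + e                                    ≡⟨ m+n∸m≡n (s + suc k) (d + e) ⟨
        s + suc k + (d + e) ∸ (s + suc k)        ≤⟨ ∸-monoˡ-≤ (s + suc k) (≤-trans (≤-reflexive (eq₆ k′ d)) (≤-trans hyp
                                                      (s≤s⁻¹ (subst (c * suc n′ <_) (*-identityˡ (suc N)) N-max)))) ⟩
        m₂                                       ∎

ramsey-bound : ∀ k′ q′ n → let q = suc q′; c = suc (suc (k′ + q)); s = suc (k′ + q) + q; r = suc (suc s) in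
  q * (r C 2) + c * suc s < c * n → Σ ℕ λ N → (q * N ≤ c * n) × RamseyProperty c r n N
ramsey-bound k′ q′ zero     hyp = contradiction (≤-trans hyp (≤-reflexive (*-zeroʳ (suc (suc (k′ + suc q′)))))) λ ()
ramsey-bound k′ q′ (suc n′) hyp with suc (suc (suc (k′ + suc q′) + suc q′)) C 2 in C≡ | 2*C2 (suc (suc (k′ + suc q′) + suc q′))
... | zero  | ()
... | suc d | 2C≡ = N , ≤-trans (≤-reflexive (*-comm q N)) (m/n*n≤m (c * suc n′) q) , ramsey
  where
  q c N : ℕ
  q = suc q′
  c = suc (suc (k′ + q))
  N = c * suc n′ / q
  N-max : c * suc n′ < q * suc N
  N-max = begin-strict
    c * suc n′                     ≡⟨ m≡m%n+[m/n]*n (c * suc n′) q ⟩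
    c * suc n′ % q + N * q         <⟨ +-monoˡ-< (N * q) (m%n<n (c * suc n′) q) ⟩
    q + N * q                      ≡⟨ *-comm (suc N) q ⟩
    q * suc N                      ∎
    where open ≤-Reasoning
  module B = Bounds k′ q′ d n′ N
  ramsey : RamseyProperty c (suc (suc B.s)) (suc n′) N
  ramsey χ with Codegree.Berge-or-sparse (suc (suc B.s)) χ (suc n′) (subst (0 <_) (sym C≡) (s≤s z≤n))
  ... | inj₁ berge  = berge
  ... | inj₂ sparse = ⊥-elim (Sparse.sparse-absurd q χ d C≡ n′ sparse B.k refl
          (B.n≤N 2C≡ hyp N-max)
          (B.room-small 2C≡ hyp N-max) (B.count-small 2C≡ hyp N-max)
          (B.room-star 2C≡ hyp N-max) (B.count-q≡1 2C≡ hyp N-max)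
          (λ _ → B.room-matching 2C≡ hyp N-max) (λ _ → B.count-q≥2 2C≡ hyp N-max) (B.weight-deficit 2C≡ hyp N-max))

theorem3 : (c r n : ℕ) → 0 < c → 0 < r → c + 1 < r → r < 2 * c →
    (r ∸ c ∸ 1) * (r C 2) + c * (r ∸ 1) < c * n →
    Σ ℕ λ N → ((r ∸ c ∸ 1) * N ≤ c * n) × RamseyProperty c r n N
theorem3 c r n _ _ c+1<r r<2c hyp with m≤n⇒∃[o]m+o≡n c+1<r
... | q′ , refl with m≤n⇒∃[o]m+o≡n (3+q′≤c c q′ r<2c)
  where
  3+q′≤c : ∀ c q′ → suc (c + 1) + q′ < 2 * c → 3 + q′ ≤ c
  3+q′≤c c q′ lt = +-cancelˡ-≤ c _ _ (subst₂ _≤_ (eq₁ c q′) (eq₂ c) lt)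
    where
    eq₁ : ∀ c q′ → suc (suc (c + 1) + q′) ≡ c + (3 + q′)
    eq₁ = solve-∀
    eq₂ : ∀ c → 2 * c ≡ c + c
    eq₂ = solve-∀
... | k′ , 3+q′+k′≡c = in-terms-of-k-and-q (trans (sym 3+q′+k′≡c) (eq₁ k′ q′))
                         (trans (cong (λ c → suc (c + 1) + q′) (sym 3+q′+k′≡c)) (eq₂ k′ q′)) hyp
  where
  eq₁ : ∀ k′ q′ → 3 + q′ + k′ ≡ suc (suc (k′ + suc q′))
  eq₁ = solve-∀
  eq₂ : ∀ k′ q′ → suc (3 + q′ + k′ + 1) + q′ ≡ suc (suc (suc (k′ + suc q′) + suc q′))
  eq₂ = solve-∀
  in-terms-of-k-and-q : ∀ {c r} → c ≡ suc (suc (k′ + suc q′)) → r ≡ suc (suc (suc (k′ + suc q′) + suc q′)) →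
    (r ∸ c ∸ 1) * (r C 2) + c * (r ∸ 1) < c * n →
    Σ ℕ λ N → ((r ∸ c ∸ 1) * N ≤ c * n) × RamseyProperty c r n N
  in-terms-of-k-and-q {c} {r} refl refl hyp =
    subst (λ q → q * (r C 2) + c * (r ∸ 1) < c * n → Σ ℕ λ N → (q * N ≤ c * n) × RamseyProperty c r n N)
      (sym (cong (_∸ 1) (trans (cong (_∸ (k′ + suc q′)) (sym (+-suc (k′ + suc q′) (suc q′)))) (m+n∸m≡n (k′ + suc q′) (suc (suc q′))))))
      (ramsey-bound k′ q′ n) hyp
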